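{- Let $q=p^s$ with $p$ an odd prime and $s\ge1$, let $n\geq 1$, let $a_1,\dots,a_n\in\mathbb{F}_q^*$ and $b\in\mathbb{F}_q^*$, and let $$N^*(n,b)=\#\{(x_1,\dots,x_n)\in(\mathbb{F}_q^*)^n\mid a_1x_1^2+\cdots+a_nx_n^2=b\}.$$ Let $\chi$ be the quadratic character of $\mathbb{F}_q^*$ and $m=\#\{1\le i\le n\mid \chi(a_i)=\chi(b)\}$. (1) If either $p\equiv1\pmod4$, or $p\equiv3\pmod4$ and $s$ is even, then $$N^*(n,b)=\frac{(q-1)^n}{q}-\frac{(-1)^n}{2q}\Big[(1-\sqrt q)^{m+1}(1+\sqrt q)^{n-m}+(1+\sqrt q)^{m+1}(1-\sqrt q)^{n-m}\Big].$$ (2) If $p\equiv3\pmod4$ and $s$ is odd, then $$N^*(n,b)=\frac{(q-1)^n}{q}-\frac{(-1)^n}{2q}\Big[(1-\sqrt q i)^{m}(1+\sqrt q i)^{n-m+1}+(1+\sqrt q i)^{m}(1-\sqrt q i)^{n-m+1}\Big],$$ where $i=\sqrt{ -1}$. -}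

module Defs where

open import Level using (Level; _⊔_) renaming (suc to lsuc)
open import Algebra.Bundles using (CommutativeRing)
open import Data.Bool using (Bool; true; false; _∧_; not; if_then_else_)
open import Data.Nat as ℕ using (ℕ; zero; suc)
open import Data.Fin using (Fin; zero; suc)
open import Data.Vec using (Vec; []; _∷_; lookup)
open import Data.List using (List; []; _∷_; [_]; map; concatMap; allFin; filterᵇ; length)
open import Data.Bool.ListAction using (any; all)
open import Data.Integer as ℤ using (ℤ; +_; -[1+_])
open import Data.Product using (∃; _×_; _,_)
open import Relation.Nullary using (¬_; does)
open import Relation.Binary.Definitions using (Decidable)
open import Relation.Binary.PropositionalEquality using (_≡_)

record FiniteField (c ℓ : Level) (q : ℕ) : Set (lsuc (c ⊔ ℓ)) where
  field
    commRing : CommutativeRing c ℓ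
  open CommutativeRing commRing public
  field
    _≟_             : Decidable _≈_
    1≉0             : ¬ (1# ≈ 0#)
    inverse         : ∀ x → ¬ (x ≈ 0#) → ∃ λ y → x * y ≈ 1#
    enum            : Fin q → Carrier
    enum-injective  : ∀ i j → enum i ≈ enum j → i ≡ j
    enum-surjective : ∀ x → ∃ λ i → enum i ≈ x

module _ {c ℓ : Level} {q : ℕ} (F : FiniteField c ℓ q) where
  open FiniteField F using (Carrier; _≈_; _≟_; _+_; _*_; 0#; enum)

  sumF : ∀ n → (Fin n → Carrier) → Carrier
  sumF zero    f = 0#
  sumF (suc n) f = f zero + sumF n (λ i → f (suc i))

  -- all n-tuples of indices into the enumeration (hence all of F^n, each once)
  allTuples : ∀ n → List (Vec (Fin q) n)
  allTuples zero    = [ [] ]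
  allTuples (suc n) = concatMap (λ i → map (i ∷_) (allTuples n)) (allFin q)

  isZeroᵇ : Carrier → Bool
  isZeroᵇ x = does (x ≟ 0#)

  isSquareᵇ : Carrier → Bool
  isSquareᵇ x = any (λ i → does ((enum i * enum i) ≟ x)) (allFin q)

  χ : Carrier → ℤ
  χ x = if isZeroᵇ x then + 0 else (if isSquareᵇ x then + 1 else -[1+ 0 ])

  Nstar : ∀ n → (Fin n → Carrier) → Carrier → ℕ
  Nstar n a b = length (filterᵇ good (allTuples n))
    where
      good : Vec (Fin q) n → Bool
      good v = all (λ i → not (isZeroᵇ (enum (lookup v i)))) (allFin n)
             ∧ does (sumF n (λ i → a i * (enum (lookup v i) * enum (lookup v i))) ≟ b)

  mCount : ∀ n → (Fin n → Carrier) → Carrier → ℕ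
  mCount n a b = length (filterᵇ (λ i → does (χ (a i) ℤ.≟ χ b)) (allFin n))

-- The ring ℤ[√d] = ℤ[X]/(X² − d), elements x + y√d represented as pairs (x , y).
ℤ[√_] : ℤ → Set
ℤ[√ d ] = ℤ × ℤ

module _ (d : ℤ) where
  infixl 6 _⊕_ _⊖_
  infixl 7 _⊗_

  _⊕_ : ℤ[√ d ] → ℤ[√ d ] → ℤ[√ d ]
  (x , y) ⊕ (u , v) = (x ℤ.+ u , y ℤ.+ v)

  _⊖_ : ℤ[√ d ] → ℤ[√ d ] → ℤ[√ d ]
  (x , y) ⊖ (u , v) = (x ℤ.- u , y ℤ.- v)

  _⊗_ : ℤ[√ d ] → ℤ[√ d ] → ℤ[√ d ]
  (x , y) ⊗ (u , v) = (x ℤ.* u ℤ.+ d ℤ.* (y ℤ.* v) , x ℤ.* v ℤ.+ y ℤ.* u)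

  _^'_ : ℤ[√ d ] → ℕ → ℤ[√ d ]
  z ^' zero  = (+ 1 , + 0)
  z ^' suc k = z ⊗ (z ^' k)

  ι : ℤ → ℤ[√ d ]
  ι k = (k , + 0)

  1+√ 1-√ : ℤ[√ d ]
  1+√ = (+ 1 , + 1)
  1-√ = (+ 1 , -[1+ 0 ])

{-# OPTIONS --safe #-}

-- As functions of b, the counts N*(n,b) lie in the span of 1, δ₀ and χ, which is closed under
-- convolution over (F,+): 1*1 = q·1, 1*χ = 0 and χ*χ = χ(-1)(q δ₀ - 1).  Since a x² = y has
-- 1 + χ(a)χ(y) - δ₀(y) solutions x ≠ 0, N*(n,·) is the convolution product of the functions
-- 1 - δ₀ + χ(aᵢ)χ.  Modulo the constants, χ behaves as a square root of d = χ(-1) q, so this product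
-- becomes (-1)ⁿ ∏ (1 - χ(aᵢ)√d) in ℤ[√d].  Finally q ≡ χ(-1) (mod 4), because
-- q - χ(-1) = ∑ (1 + χ(y))(1 + χ(1 - y)).
module Submission where

open import Defs
open import Level using (Level)
open import Data.Nat using (ℕ; _^_; _≥_; _%_; _∸_)
open import Data.Nat.Primality using (Prime)
open import Data.Fin using (Fin)
open import Data.Integer using (ℤ; +_; -_; -[1+_])
open import Data.Integer as ℤ using ()
open import Data.Product using (_×_)
open import Data.Sum using (_⊎_)
open import Relation.Nullary using (¬_)
open import Relation.Binary.PropositionalEquality using (_≡_)

open import Algebra.Properties.CommutativeSemigroup using (interchange)
import Algebra.Properties.Ring as RingProperties
import Algebra.Properties.Semiring.Sum as SemiringSum
open import Data.Bool using (Bool; true; false; if_then_else_; T; _∧_; not)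
open import Data.Bool.ListAction using (and; all)
open import Data.Bool.Properties using (T-≡; T?; ∧-assoc)
open import Data.Fin using (zero; suc; punchIn; _<?_)
open import Data.Fin.Permutation using (permutation)
open import Data.Fin.Properties using (punchInᵢ≢i; <-cmp)
open import Data.Integer using (1ℤ; 0ℤ; -1ℤ; _+_; _*_; _-_)
open import Data.Integer.Divisibility.Signed using (_∣_; divides; ∣⇒∣ᵤ; ∣m∣n⇒∣m+n; ∣m+n∣m⇒∣n)
import Data.Integer.Properties as ℤₚ
open import Data.Integer.Tactic.RingSolver using (solve-∀)
open import Data.List using (List; []; _∷_; _++_; allFin; concatMap; filterᵇ; length; map; tabulate)
open import Data.List.Membership.Propositional using (lose)
open import Data.List.Membership.Propositional.Properties using (∈-allFin)
open import Data.List.Properties using (filter-++; length-++; map-tabulate; length-filter; length-tabulate)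
import Data.List.Relation.Unary.Any as Any
open import Data.List.Relation.Unary.Any.Properties using (any⁺; any⁻)
import Data.Nat as ℕ
open import Data.Nat.DivMod using (%-distribˡ-+; %-distribˡ-*)
open import Data.Nat.Divisibility using (n∣m⇒m%n≡0)
import Data.Nat.Properties as ℕₚ
open import Data.Product using (∃; _,_; proj₁; proj₂)
open import Data.Sum using (inj₁; inj₂; [_,_]′)
open import Data.Vec using (Vec; _∷_; lookup)
open import Function using (_∘_; mk⇔; Equivalence)
open import Relation.Binary.Definitions using (tri<; tri≈; tri>)
open import Relation.Binary.PropositionalEquality using (_≢_; refl; sym; trans; cong; cong₂; subst; module ≡-Reasoning)
open import Relation.Nullary using (Dec; yes; no; does; contradiction)
open import Relation.Nullary.Decidable using (dec-true; dec-false; does-⇔; map′; decidable-stable; toSum)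

open SemiringSum ℤₚ.+-*-semiring using (sum; sum-cong-≗; ∑-distrib-+; ∑-comm; sum-permute; sum-remove; *-distribˡ-sum)

-- Put `E = q δ₀ - 1`. Then `1 * E = 0` and `E * E = q E`, so convolution splits the span into the
-- constants and the sum-zero part spanned by `E` and `χ`. On that part `E / q` is the identity and
-- `χ * χ = d (E / q)`, which makes it a copy of ℚ[X]/(X² - d). The factor `1 - δ₀ + χ(aᵢ)χ` has
-- total `q - 1` and projects to `-(1 - χ(aᵢ)√d)`; the totals account for the term `(q - 1)ⁿ / q`.
-- At `b ≠ 0` the elements 1 and √d take the values `-1/q` and `χ(b)`, so `u + v√d` has the value
-- `-(u - q χ(b) v) / q`. Since `q = ±d`, the bracket is the rational part of `u + v√d` times one
-- further factor `1 ∓ χ(b)√d`. The sign of `d` decides which of the two powers in the result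
-- receives it, and the half-sum of conjugates extracts the rational part. The multiplicativity of
-- `χ` behind all this is itself drawn from a sum, namely from `∑ χ = 0`.

-- Integer indicators and finite sums.

𝟙 : ∀ {a} {A : Set a} → Dec A → ℤ
𝟙 A? = if does A? then 1ℤ else 0ℤ

module _ {a} {A : Set a} where

  𝟙-yes : (A? : Dec A) → A → 𝟙 A? ≡ 1ℤ
  𝟙-yes A? x = cong (if_then 1ℤ else 0ℤ) (dec-true A? x)

  𝟙-no : (A? : Dec A) → ¬ A → 𝟙 A? ≡ 0ℤ
  𝟙-no A? ¬x = cong (if_then 1ℤ else 0ℤ) (dec-false A? ¬x)

  𝟙-⇔ : ∀ {b} {B : Set b} (A? : Dec A) (B? : Dec B) → (A → B) → (B → A) → 𝟙 A? ≡ 𝟙 B?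
  𝟙-⇔ A? B? f g = cong (if_then 1ℤ else 0ℤ) (does-⇔ (mk⇔ f g) A? B?)

sum-zero : ∀ {n} (f : Fin n → ℤ) → (∀ i → f i ≡ 0ℤ) → sum f ≡ 0ℤ
sum-zero {ℕ.zero}  f f≡0 = refl
sum-zero {ℕ.suc n} f f≡0 = cong₂ _+_ (f≡0 zero) (sum-zero (f ∘ suc) (f≡0 ∘ suc))

sum-const : ∀ n k → sum {n} (λ _ → k) ≡ + n * k
sum-const ℕ.zero    k = refl
sum-const (ℕ.suc n) k = trans (cong (_+_ k) (sum-const n k)) (sym (ℤₚ.suc-* (+ n) k))

sum-Kronecker : ∀ {n} (j : Fin n) (f : Fin n → ℤ) → (∀ i → i ≢ j → f i ≡ 0ℤ) → sum f ≡ f j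
sum-Kronecker {ℕ.suc n} j f f≡0 =
  trans (sum-remove f) (trans (cong (_+_ (f j)) (sum-zero _ (λ i → f≡0 _ (punchInᵢ≢i j i)))) (ℤₚ.+-identityʳ _))

sum-∣ : ∀ {n} {k} (f : Fin n → ℤ) → (∀ i → k ∣ f i) → k ∣ sum f
sum-∣ {ℕ.zero}  {k} f k∣f = divides 0ℤ refl
sum-∣ {ℕ.suc n} f k∣f = ∣m∣n⇒∣m+n (k∣f zero) (sum-∣ (f ∘ suc) (k∣f ∘ suc))

sum-nonpos : ∀ {n} (f : Fin n → ℤ) → (∀ i → f i ℤ.≤ 0ℤ) → sum f ℤ.≤ 0ℤ
sum-nonpos {ℕ.zero}  f f≤0 = ℤₚ.≤-refl
sum-nonpos {ℕ.suc n} f f≤0 = ℤₚ.+-mono-≤ (f≤0 zero) (sum-nonpos (f ∘ suc) (f≤0 ∘ suc))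

-- The terms other than `f i` add up to at most 0, so `f i` is at least the whole sum. This turns
-- one vanishing sum into a pointwise identity.
nonpos-sum≡0 : ∀ {n} (f : Fin n → ℤ) → (∀ i → f i ℤ.≤ 0ℤ) → sum f ≡ 0ℤ → ∀ i → f i ≡ 0ℤ
nonpos-sum≡0 {ℕ.suc n} f f≤0 ∑≡0 i = ℤₚ.≤-antisym (f≤0 i) (begin
  0ℤ                                   ≡⟨ ∑≡0 ⟨
  sum f                                ≡⟨ sum-remove {i = i} f ⟩
  f i + sum (λ j → f (punchIn i j))    ≤⟨ ℤₚ.+-monoʳ-≤ (f i) (sum-nonpos _ (λ j → f≤0 (punchIn i j))) ⟩
  f i + 0ℤ                             ≡⟨ ℤₚ.+-identityʳ _ ⟩
  f i                                  ∎)
  where open ℤₚ.≤-Reasoning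

-- Sums over a finite field and their changes of variable.

module FieldSums {c ℓ : Level} {q : ℕ} (F : FiniteField c ℓ q) where

  open FiniteField F
    renaming ( _+_ to _+ᶠ_; _*_ to _*ᶠ_; -_ to -ᶠ_; _-_ to _-ᶠ_; refl to ≈-refl; sym to ≈-sym; trans to ≈-trans )
  open RingProperties ring using (+-cancelʳ)

  Congruent : (Carrier → ℤ) → Set _
  Congruent f = ∀ {x y} → x ≈ y → f x ≡ f y

  ∑ : (Carrier → ℤ) → ℤ
  ∑ f = sum (f ∘ enum)

  index : Carrier → Fin q
  index x = proj₁ (enum-surjective x)

  enum-index : ∀ x → enum (index x) ≈ x
  enum-index x = proj₂ (enum-surjective x)

  ∑-cong : ∀ {f g} → (∀ x → f x ≡ g x) → ∑ f ≡ ∑ g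
  ∑-cong f≡g = sum-cong-≗ (λ i → f≡g (enum i))

  ∑-+ : ∀ f g → ∑ (λ x → f x + g x) ≡ ∑ f + ∑ g
  ∑-+ f g = ∑-distrib-+ (f ∘ enum) (g ∘ enum)

  ∑-*ˡ : ∀ k f → ∑ (λ x → k * f x) ≡ k * ∑ f
  ∑-*ˡ k f = sym (*-distribˡ-sum k (f ∘ enum))

  ∑-lin : ∀ k l f g → ∑ (λ x → k * f x + l * g x) ≡ k * ∑ f + l * ∑ g
  ∑-lin k l f g = trans (∑-+ (λ x → k * f x) (λ x → l * g x)) (cong₂ _+_ (∑-*ˡ k f) (∑-*ˡ l g))

  ∑-swap : ∀ (f : Carrier → Carrier → ℤ) → ∑ (λ x → ∑ (f x)) ≡ ∑ (λ y → ∑ (λ x → f x y))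
  ∑-swap f = ∑-comm (λ i j → f (enum i) (enum j))

  ∑-1 : ∑ (λ _ → 1ℤ) ≡ + q
  ∑-1 = trans (sum-const q 1ℤ) (ℤₚ.*-identityʳ (+ q))

  -- The maps are inverse only up to `≈`, while the sums run over `Fin q`. Conjugating with `enum`
  -- and `index` gives a genuine permutation, because `enum` is injective.
  ∑-reindex : ∀ f → Congruent f → (g h : Carrier → Carrier) →
    (∀ {x y} → x ≈ y → g x ≈ g y) → (∀ {x y} → x ≈ y → h x ≈ h y) →
    (∀ x → g (h x) ≈ x) → (∀ x → h (g x) ≈ x) → ∑ (f ∘ g) ≡ ∑ f
  ∑-reindex f f-cong g h g-cong h-cong gh hg =
    trans (sum-cong-≗ (λ i → f-cong (≈-sym (enum-index (g (enum i))))))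
          (sym (sum-permute (f ∘ enum) (permutation (lift g) (lift h) (inverse′ g h g-cong gh) (inverse′ h g h-cong hg))))
    where
    lift : (Carrier → Carrier) → Fin q → Fin q
    lift k i = index (k (enum i))
    inverse′ : ∀ k l → (∀ {x y} → x ≈ y → k x ≈ k y) → (∀ x → k (l x) ≈ x) → ∀ i → lift k (lift l i) ≡ i
    inverse′ k l k-cong kl i = enum-injective _ _
      (≈-trans (enum-index _) (≈-trans (k-cong (enum-index _)) (kl (enum i))))

  δ : Carrier → Carrier → ℤ
  δ x y = 𝟙 (x ≟ y)

  δ-cong : ∀ {x x′ y y′} → x ≈ x′ → y ≈ y′ → δ x y ≡ δ x′ y′
  δ-cong x≈x′ y≈y′ = 𝟙-⇔ (_ ≟ _) (_ ≟ _)
    (λ x≈y → ≈-trans (≈-sym x≈x′) (≈-trans x≈y y≈y′)) (λ x≈y → ≈-trans x≈x′ (≈-trans x≈y (≈-sym y≈y′)))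

  δ-sym : ∀ x y → δ x y ≡ δ y x
  δ-sym x y = 𝟙-⇔ (x ≟ y) (y ≟ x) ≈-sym ≈-sym

  ∑-δ : ∀ y f → Congruent f → ∑ (λ x → δ x y * f x) ≡ f y
  ∑-δ y f f-cong = begin
    ∑ (λ x → δ x y * f x)                                ≡⟨ sum-Kronecker (index y) _ off ⟩
    δ (enum (index y)) y * f (enum (index y))            ≡⟨ cong₂ _*_ (𝟙-yes (_ ≟ _) (enum-index y)) (f-cong (enum-index y)) ⟩
    1ℤ * f y                                             ≡⟨ ℤₚ.*-identityˡ (f y) ⟩
    f y                                                  ∎
    where
    open ≡-Reasoning
    off : ∀ i → i ≢ index y → δ (enum i) y * f (enum i) ≡ 0ℤ
    off i i≢ = cong (_* f (enum i)) (𝟙-no (_ ≟ _) λ e → i≢ (enum-injective _ _ (≈-trans e (≈-sym (enum-index y)))))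

  ∑-δ-1 : ∀ y → ∑ (λ x → δ x y) ≡ 1ℤ
  ∑-δ-1 y = trans (∑-cong (λ x → sym (ℤₚ.*-identityʳ (δ x y)))) (∑-δ y (λ _ → 1ℤ) (λ _ → refl))

  -- totalised by inv 0 = 0
  inv-spec : ∀ x → ∃ λ y → (x ≈ 0# → y ≈ 0#) × (¬ x ≈ 0# → x *ᶠ y ≈ 1#)
  inv-spec x with x ≟ 0#
  ... | yes x≈0 = 0# , (λ _ → ≈-refl) , (λ x≉0 → contradiction x≈0 x≉0)
  ... | no  x≉0 = proj₁ (inverse x x≉0) , (λ x≈0 → contradiction x≈0 x≉0) , (λ _ → proj₂ (inverse x x≉0))

  inv : Carrier → Carrier
  inv x = proj₁ (inv-spec x)

  inv-zero : ∀ {x} → x ≈ 0# → inv x ≈ 0#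
  inv-zero {x} = proj₁ (proj₂ (inv-spec x))

  inv-right : ∀ {x} → ¬ x ≈ 0# → x *ᶠ inv x ≈ 1#
  inv-right {x} = proj₂ (proj₂ (inv-spec x))

  inv-left : ∀ {x} → ¬ x ≈ 0# → inv x *ᶠ x ≈ 1#
  inv-left x≉0 = ≈-trans (*-comm _ _) (inv-right x≉0)

  *-cancelˡ-nonZero : ∀ {x y z} → ¬ x ≈ 0# → x *ᶠ y ≈ x *ᶠ z → y ≈ z
  *-cancelˡ-nonZero {x} {y} {z} x≉0 e = ≈-trans (≈-sym (undo y)) (≈-trans (*-congˡ e) (undo z))
    where
    undo : ∀ w → inv x *ᶠ (x *ᶠ w) ≈ w
    undo w = ≈-trans (≈-sym (*-assoc _ _ _)) (≈-trans (*-congʳ (inv-left x≉0)) (*-identityˡ w))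

  *-nonZero : ∀ {x y} → ¬ x ≈ 0# → ¬ y ≈ 0# → ¬ x *ᶠ y ≈ 0#
  *-nonZero x≉0 y≉0 xy≈0 = y≉0 (*-cancelˡ-nonZero x≉0 (≈-trans xy≈0 (≈-sym (zeroʳ _))))

  *-≉0ʳ : ∀ {x y} → ¬ x *ᶠ y ≈ 0# → ¬ y ≈ 0#
  *-≉0ʳ xy≉0 y≈0 = xy≉0 (≈-trans (*-congˡ y≈0) (zeroʳ _))

  inv-nonZero : ∀ {x} → ¬ x ≈ 0# → ¬ inv x ≈ 0#
  inv-nonZero x≉0 = *-≉0ʳ (λ e → 1≉0 (≈-trans (≈-sym (inv-right x≉0)) e))

  inv-cong : ∀ {x y} → x ≈ y → inv x ≈ inv y
  inv-cong {x} {y} x≈y with toSum (x ≟ 0#)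
  ... | inj₁ x≈0 = ≈-trans (inv-zero x≈0) (≈-sym (inv-zero (≈-trans (≈-sym x≈y) x≈0)))
  ... | inj₂ x≉0 = *-cancelˡ-nonZero x≉0 (≈-trans (inv-right x≉0)
                    (≈-trans (≈-sym (inv-right (λ y≈0 → x≉0 (≈-trans x≈y y≈0)))) (*-congʳ (≈-sym x≈y))))

  -- The default value at 0 makes inversion an involution of the whole field, so that it is a change
  -- of variable in `∑`.
  inv-involutive : ∀ x → inv (inv x) ≈ x
  inv-involutive x with toSum (x ≟ 0#)
  ... | inj₁ x≈0 = ≈-trans (inv-zero (inv-zero x≈0)) (≈-sym x≈0)
  ... | inj₂ x≉0 = *-cancelˡ-nonZero (inv-nonZero x≉0) (≈-trans (inv-right (inv-nonZero x≉0)) (≈-sym (inv-left x≉0)))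

  x+y-y : ∀ x y → (x +ᶠ y) -ᶠ y ≈ x
  x+y-y x y = ≈-trans (+-assoc _ _ _) (≈-trans (+-congˡ (-‿inverseʳ y)) (+-identityʳ x))

  x-y+y : ∀ x y → (x -ᶠ y) +ᶠ y ≈ x
  x-y+y x y = ≈-trans (+-assoc _ _ _) (≈-trans (+-congˡ (-‿inverseˡ y)) (+-identityʳ x))

  x-[x-y] : ∀ x y → x -ᶠ (x -ᶠ y) ≈ y
  x-[x-y] x y = +-cancelʳ (x -ᶠ y) _ _ (≈-trans (x-y+y _ _) (≈-trans (≈-sym (x-y+y x y)) (+-comm _ _)))

  -‿congˡ : ∀ {x y z} → y ≈ z → x -ᶠ y ≈ x -ᶠ z
  -‿congˡ y≈z = +-congˡ (-‿cong y≈z)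

  ∑-scale : ∀ {a} → ¬ a ≈ 0# → ∀ f → Congruent f → ∑ (λ x → f (a *ᶠ x)) ≡ ∑ f
  ∑-scale {a} a≉0 f f-cong = ∑-reindex f f-cong (a *ᶠ_) (inv a *ᶠ_) *-congˡ *-congˡ
    (undo (inv-right a≉0)) (undo (inv-left a≉0))
    where
    undo : ∀ {y z} → y *ᶠ z ≈ 1# → ∀ x → y *ᶠ (z *ᶠ x) ≈ x
    undo yz x = ≈-trans (≈-sym (*-assoc _ _ _)) (≈-trans (*-congʳ yz) (*-identityˡ x))

  ∑-shift : ∀ a f → Congruent f → ∑ (λ x → f (x -ᶠ a)) ≡ ∑ f
  ∑-shift a f f-cong = ∑-reindex f f-cong (_-ᶠ a) (_+ᶠ a) +-congʳ +-congʳ (λ x → x+y-y x a) (λ x → x-y+y x a)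

  ∑-reflect : ∀ a f → Congruent f → ∑ (λ x → f (a -ᶠ x)) ≡ ∑ f
  ∑-reflect a f f-cong = ∑-reindex f f-cong (_-ᶠ_ a) (_-ᶠ_ a) -‿congˡ -‿congˡ (x-[x-y] a) (x-[x-y] a)

  ∑-inv : ∀ f → Congruent f → ∑ (λ x → f (inv x)) ≡ ∑ f
  ∑-inv f f-cong = ∑-reindex f f-cong inv inv inv-cong inv-cong inv-involutive inv-involutive

-- The quadratic character and its multiplicativity.

module QuadraticCharacter {c ℓ : Level} {q : ℕ} (F : FiniteField c ℓ q) (q-odd : q % 2 ≡ 1) where

  open FieldSums F
  open FiniteField F
    renaming ( _+_ to _+ᶠ_; _*_ to _*ᶠ_; -_ to -ᶠ_; _-_ to _-ᶠ_; refl to ≈-refl; sym to ≈-sym; trans to ≈-trans )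
  open RingProperties ring using (-‿distribˡ-*; -‿distribʳ-*; x[y-z]≈xy-xz; -0#≈0#; x∙y⁻¹≈ε⇒x≈y; -‿involutive)

  ε : ℤ
  ε = χ F (-ᶠ 1#)

  -- If 1 + 1 ≈ 0, then x ↦ x + 1 is an involution without fixed points, so q is even.
  2≉0 : ¬ 1# +ᶠ 1# ≈ 0#
  2≉0 2≈0 = contradiction (trans (sym q-odd) (n∣m⇒m%n≡0 q 2 (∣⇒∣ᵤ 2∣q))) λ ()
    where
    index-cong : ∀ {x y} → x ≈ y → index x ≡ index y
    index-cong x≈y = enum-injective _ _ (≈-trans (enum-index _) (≈-trans x≈y (≈-sym (enum-index _))))
    +1+1 : ∀ x → (x +ᶠ 1#) +ᶠ 1# ≈ x
    +1+1 x = ≈-trans (+-assoc _ _ _) (≈-trans (+-congˡ 2≈0) (+-identityʳ x))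
    -- `up` marks the member of each pair `{x, x + 1}` with the smaller index, so `∑ up` is the
    -- number of pairs.
    up : Carrier → ℤ
    up x = 𝟙 (index x <? index (x +ᶠ 1#))
    up-cong : Congruent up
    up-cong x≈y = cong₂ (λ i j → 𝟙 (i <? j)) (index-cong x≈y) (index-cong (+-congʳ x≈y))
    ≉+1 : ∀ x → index x ≢ index (x +ᶠ 1#)
    ≉+1 x e = 1≉0 (≈-trans (≈-sym (≈-trans (+-congʳ (-‿inverseˡ x)) (+-identityˡ 1#)))
      (≈-trans (+-assoc _ _ _) (≈-trans (+-congˡ (≈-sym x≈x+1)) (-‿inverseˡ x))))
      where
      x≈x+1 : x ≈ x +ᶠ 1#
      x≈x+1 = ≈-trans (≈-sym (enum-index x)) (≈-trans (reflexive (cong enum e)) (enum-index (x +ᶠ 1#)))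
    up+up : ∀ x → up x + up (x +ᶠ 1#) ≡ 1ℤ
    up+up x rewrite index-cong (+1+1 x) with <-cmp (index x) (index (x +ᶠ 1#))
    ... | tri< lt _ ¬gt = cong₂ _+_ (𝟙-yes (_ <? _) lt) (𝟙-no (_ <? _) ¬gt)
    ... | tri≈ _ e _ = contradiction e (≉+1 x)
    ... | tri> ¬lt _ gt = cong₂ _+_ (𝟙-no (_ <? _) ¬lt) (𝟙-yes (_ <? _) gt)
    2∣q : + 2 ∣ + q
    2∣q = divides (∑ up) (begin
      + q                                ≡⟨ ∑-1 ⟨
      ∑ (λ _ → 1ℤ)                       ≡⟨ ∑-cong up+up ⟨
      ∑ (λ x → up x + up (x +ᶠ 1#))      ≡⟨ ∑-+ up (λ x → up (x +ᶠ 1#)) ⟩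
      ∑ up + ∑ (λ x → up (x +ᶠ 1#))      ≡⟨ cong (_+_ (∑ up)) (∑-reindex up up-cong (_+ᶠ 1#) (_+ᶠ 1#) +-congʳ +-congʳ +1+1 +1+1) ⟩
      ∑ up + ∑ up                        ≡⟨ double (∑ up) ⟩
      ∑ up * + 2                         ∎)
      where
      open ≡-Reasoning
      double : ∀ z → z + z ≡ z * + 2
      double = solve-∀

  IsSquare : Carrier → Set _
  IsSquare x = ∃ λ r → r *ᶠ r ≈ x

  -- Built by `map′` over `T?`, so that its `does` reduces to the Boolean `isSquareᵇ F x` inside
  -- `χ`, which `dec-true` and `dec-false` can then rewrite.
  isSquare? : ∀ x → Dec (IsSquare x)
  isSquare? x = map′ from to (T? (isSquareᵇ F x))
    where
    from : T (isSquareᵇ F x) → IsSquare x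
    from t with Any.satisfied (any⁻ _ (allFin q) t)
    ... | i , ti with (enum i *ᶠ enum i) ≟ x
    ... | yes e = enum i , e
    to : IsSquare x → T (isSquareᵇ F x)
    to (r , r²≈x) = any⁺ _ (lose (∈-allFin (index r))
      (Equivalence.from T-≡ (dec-true (_ ≟ _) (≈-trans (*-cong (enum-index r) (enum-index r)) r²≈x))))

  χ-cong : Congruent (χ F)
  χ-cong x≈y = cong₂ (λ b s → if b then + 0 else (if s then + 1 else -[1+ 0 ]))
    (does-⇔ (mk⇔ (≈-trans (≈-sym x≈y)) (≈-trans x≈y)) (_ ≟ _) (_ ≟ _))
    (does-⇔ (mk⇔ (λ (r , e) → r , ≈-trans e x≈y) (λ (r , e) → r , ≈-trans e (≈-sym x≈y))) (isSquare? _) (isSquare? _))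

  χ-zero : ∀ {x} → x ≈ 0# → χ F x ≡ 0ℤ
  χ-zero {x} x≈0 rewrite dec-true (x ≟ 0#) x≈0 = refl

  χ-square : ∀ {x} → ¬ x ≈ 0# → IsSquare x → χ F x ≡ 1ℤ
  χ-square {x} x≉0 s rewrite dec-false (x ≟ 0#) x≉0 | dec-true (isSquare? x) s = refl

  χ-nonsquare : ∀ {x} → ¬ IsSquare x → χ F x ≡ -1ℤ
  χ-nonsquare {x} ¬s rewrite dec-false (x ≟ 0#) (λ x≈0 → ¬s (0# , ≈-trans (zeroˡ 0#) (≈-sym x≈0)))
                           | dec-false (isSquare? x) ¬s = refl

  data Class (x : Carrier) : Set (c Level.⊔ ℓ) where
    zeroᶜ      : x ≈ 0# → χ F x ≡ 0ℤ → Class x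
    square     : ∀ r → ¬ r ≈ 0# → r *ᶠ r ≈ x → χ F x ≡ 1ℤ → Class x
    nonsquare  : ¬ IsSquare x → χ F x ≡ -1ℤ → Class x

  -- Splitting on `toSum (x ≟ 0#)` instead of `x ≟ 0#` leaves the occurrence of the decision inside
  -- `χ` intact; the value of `χ` is delivered as an equation.
  classify : ∀ x → Class x
  classify x with toSum (x ≟ 0#) | toSum (isSquare? x)
  ... | inj₁ x≈0 | _ = zeroᶜ x≈0 (χ-zero x≈0)
  ... | inj₂ x≉0 | inj₁ (r , e) = square r (λ r≈0 → x≉0 (≈-trans (≈-sym e) (≈-trans (*-congʳ r≈0) (zeroˡ r)))) e (χ-square x≉0 (r , e))
  ... | inj₂ x≉0 | inj₂ ¬s = nonsquare ¬s (χ-nonsquare ¬s)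

  χ-± : ∀ {x} → ¬ x ≈ 0# → χ F x ≡ 1ℤ ⊎ χ F x ≡ -1ℤ
  χ-± {x} x≉0 with classify x
  ... | zeroᶜ x≈0 _    = contradiction x≈0 x≉0
  ... | square _ _ _ e = inj₁ e
  ... | nonsquare _ e  = inj₂ e

  χ-opposite : ∀ {x y} → ¬ x ≈ 0# → ¬ y ≈ 0# → χ F x ≢ χ F y → - χ F x ≡ χ F y
  χ-opposite x≉0 y≉0 χx≢χy with χ-± x≉0 | χ-± y≉0
  ... | inj₁ e | inj₁ e′ = contradiction (trans e (sym e′)) χx≢χy
  ... | inj₁ e | inj₂ e′ = trans (cong -_ e) (sym e′)
  ... | inj₂ e | inj₁ e′ = trans (cong -_ e) (sym e′)
  ... | inj₂ e | inj₂ e′ = contradiction (trans e (sym e′)) χx≢χy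

  χ² : ∀ {x} → ¬ x ≈ 0# → χ F x * χ F x ≡ 1ℤ
  χ² x≉0 with χ-± x≉0
  ... | inj₁ e = cong₂ _*_ e e
  ... | inj₂ e = cong₂ _*_ e e

  χ≤1 : ∀ x → χ F x ℤ.≤ 1ℤ
  χ≤1 x with classify x
  ... | zeroᶜ _ e      = subst (ℤ._≤ 1ℤ) (sym e) (ℤ.+≤+ ℕ.z≤n)
  ... | square _ _ _ e = ℤₚ.≤-reflexive e
  ... | nonsquare _ e  = subst (ℤ._≤ 1ℤ) (sym e) ℤ.-≤+

  χ-square-* : ∀ {r} x → ¬ r ≈ 0# → χ F ((r *ᶠ r) *ᶠ x) ≡ χ F x
  χ-square-* {r} x r≉0 with classify x
  ... | zeroᶜ x≈0 e = trans (χ-zero (≈-trans (*-congˡ x≈0) (zeroʳ _))) (sym e)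
  ... | square s s≉0 s²≈x e = trans
        (χ-square (*-nonZero (*-nonZero r≉0 r≉0) (λ x≈0 → *-nonZero s≉0 s≉0 (≈-trans s²≈x x≈0)))
                  (r *ᶠ s , ≈-trans (interchange *-commutativeSemigroup r s r s) (*-congˡ s²≈x)))
        (sym e)
  -- A root `s` of `r² x` would give the root `s / r` of `x`.
  ... | nonsquare ¬s e = trans (χ-nonsquare (λ (s , s²≈r²x) → ¬s (inv r *ᶠ s ,
          ≈-trans (interchange *-commutativeSemigroup (inv r) s (inv r) s) (≈-trans (*-congˡ s²≈r²x)
          (≈-trans (≈-sym (*-assoc _ _ _)) (≈-trans (*-congʳ
            (≈-trans (interchange *-commutativeSemigroup (inv r) (inv r) r r)
            (≈-trans (*-cong (inv-left r≉0) (inv-left r≉0)) (*-identityˡ 1#)))) (*-identityˡ x)))))))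
        (sym e)

  square-eq : ∀ {x r} → x *ᶠ x ≈ r *ᶠ r → x ≈ r ⊎ x ≈ -ᶠ r
  square-eq {x} {r} x²≈r² with toSum (x ≟ r)
  ... | inj₁ x≈r = inj₁ x≈r
  ... | inj₂ x≉r = inj₂ (x∙y⁻¹≈ε⇒x≈y x (-ᶠ r) (≈-trans (+-congˡ (-‿involutive r))
      (*-cancelˡ-nonZero {x -ᶠ r} (λ e → x≉r (x∙y⁻¹≈ε⇒x≈y x r e)) (≈-trans product (≈-sym (zeroʳ _))))))
    where
    open import Relation.Binary.Reasoning.Setoid setoid
    product : (x -ᶠ r) *ᶠ (x +ᶠ r) ≈ 0#
    product = begin
      (x -ᶠ r) *ᶠ (x +ᶠ r)                         ≈⟨ distribˡ _ x r ⟩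
      (x -ᶠ r) *ᶠ x +ᶠ (x -ᶠ r) *ᶠ r               ≈⟨ +-cong (*-comm _ _) (*-comm _ _) ⟩
      x *ᶠ (x -ᶠ r) +ᶠ r *ᶠ (x -ᶠ r)               ≈⟨ +-cong (x[y-z]≈xy-xz x x r) (x[y-z]≈xy-xz r x r) ⟩
      (x *ᶠ x -ᶠ x *ᶠ r) +ᶠ (r *ᶠ x -ᶠ r *ᶠ r)     ≈⟨ +-congˡ (+-cong (*-comm r x) (-‿cong (≈-sym x²≈r²))) ⟩
      (x *ᶠ x -ᶠ x *ᶠ r) +ᶠ (x *ᶠ r -ᶠ x *ᶠ x)     ≈⟨ +-assoc _ _ _ ⟨
      ((x *ᶠ x -ᶠ x *ᶠ r) +ᶠ x *ᶠ r) -ᶠ x *ᶠ x     ≈⟨ +-congʳ (x-y+y _ _) ⟩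
      x *ᶠ x -ᶠ x *ᶠ x                             ≈⟨ -‿inverseʳ _ ⟩
      0#                                           ∎

  -x*-x : ∀ x → -ᶠ x *ᶠ -ᶠ x ≈ x *ᶠ x
  -x*-x x = ≈-trans (≈-sym (-‿distribˡ-* x (-ᶠ x))) (≈-trans (-‿cong (≈-sym (-‿distribʳ-* x x))) (-‿involutive _))

  x≉-x : ∀ {x} → ¬ x ≈ 0# → ¬ x ≈ -ᶠ x
  x≉-x {x} x≉0 x≈-x = *-nonZero 2≉0 x≉0 (≈-trans (distribʳ x 1# 1#)
    (≈-trans (+-cong (*-identityˡ x) (≈-trans (*-identityˡ x) x≈-x)) (-‿inverseʳ x)))

  -- The fibre of squaring over `y` is `{0}`, empty, or `{r, -r}`; in the last case it has two
  -- elements because `1 + 1` is nonzero.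
  count-√ : ∀ y → ∑ (λ x → δ (x *ᶠ x) y) ≡ 1ℤ + χ F y
  count-√ y with classify y
  ... | zeroᶜ y≈0 e = trans (∑-cong (λ x → 𝟙-⇔ (_ ≟ _) (_ ≟ _)
          (λ x²≈y → decidable-stable (x ≟ 0#) (λ x≉0 → *-nonZero x≉0 x≉0 (≈-trans x²≈y y≈0)))
          (λ x≈0 → ≈-trans (*-congʳ x≈0) (≈-trans (zeroˡ x) (≈-sym y≈0)))))
        (trans (∑-δ-1 0#) (cong (_+_ 1ℤ) (sym e)))
  ... | nonsquare ¬s e = trans (sum-zero (λ i → δ (enum i *ᶠ enum i) y) (λ i → 𝟙-no (_ ≟ _) (λ e → ¬s (_ , e)))) (cong (_+_ 1ℤ) (sym e))
  ... | square r r≉0 r²≈y e = trans (∑-cong split)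
        (trans (∑-+ (λ x → δ x r) (λ x → δ x (-ᶠ r))) (trans (cong₂ _+_ (∑-δ-1 r) (∑-δ-1 (-ᶠ r))) (cong (_+_ 1ℤ) (sym e))))
    where
    split : ∀ x → δ (x *ᶠ x) y ≡ δ x r + δ x (-ᶠ r)
    split x with toSum (x ≟ r) | toSum (x ≟ (-ᶠ r))
    ... | inj₁ x≈r | _ = trans (𝟙-yes (_ ≟ _) (≈-trans (*-cong x≈r x≈r) r²≈y))
          (sym (cong₂ _+_ (𝟙-yes (_ ≟ _) x≈r) (𝟙-no (_ ≟ _) (λ x≈-r → x≉-x r≉0 (≈-trans (≈-sym x≈r) x≈-r)))))
    ... | inj₂ x≉r | inj₁ x≈-r = trans (𝟙-yes (_ ≟ _) (≈-trans (*-cong x≈-r x≈-r) (≈-trans (-x*-x r) r²≈y)))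
          (sym (cong₂ _+_ (𝟙-no (_ ≟ _) x≉r) (𝟙-yes (_ ≟ _) x≈-r)))
    ... | inj₂ x≉r | inj₂ x≉-r = trans (𝟙-no (_ ≟ _) (λ x²≈y → [ x≉r , x≉-r ]′ (square-eq (≈-trans x²≈y (≈-sym r²≈y)))))
          (sym (cong₂ _+_ (𝟙-no (_ ≟ _) x≉r) (𝟙-no (_ ≟ _) x≉-r)))

  -- Each `x` has exactly one square, so the fibre sizes `1 + χ(y)` add up to `q`, which the
  -- summands 1 already do alone.
  ∑-χ : ∑ (χ F) ≡ 0ℤ
  ∑-χ = RingProperties.+-cancelˡ ℤₚ.+-*-ring (+ q) (∑ (χ F)) 0ℤ (begin
    + q + ∑ (χ F)                           ≡⟨ cong (_+ ∑ (χ F)) ∑-1 ⟨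
    ∑ (λ _ → 1ℤ) + ∑ (χ F)                  ≡⟨ ∑-+ (λ _ → 1ℤ) (χ F) ⟨
    ∑ (λ y → 1ℤ + χ F y)                    ≡⟨ ∑-cong count-√ ⟨
    ∑ (λ y → ∑ (λ x → δ (x *ᶠ x) y))        ≡⟨ ∑-swap (λ x y → δ (x *ᶠ x) y) ⟨
    ∑ (λ x → ∑ (λ y → δ (x *ᶠ x) y))        ≡⟨ ∑-cong (λ x → trans (∑-cong (λ y → δ-sym (x *ᶠ x) y)) (∑-δ-1 (x *ᶠ x))) ⟩
    ∑ (λ x → 1ℤ)                            ≡⟨ ∑-1 ⟩
    + q                                     ≡⟨ ℤₚ.+-identityʳ (+ q) ⟨
    + q + 0ℤ                                ∎)
    where open ≡-Reasoning

  -- χ(ay) + χ(y) ≤ 0 for every y, and these numbers sum to 0.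
  nonsquare-* : ∀ {a} → ¬ IsSquare a → ∀ y → χ F (a *ᶠ y) + χ F y ≡ 0ℤ
  nonsquare-* {a} ¬s y = trans (sym (f-cong (enum-index y)))
    (nonpos-sum≡0 (f ∘ enum) (f≤0 ∘ enum)
      (trans (∑-+ (λ y → χ F (a *ᶠ y)) (χ F)) (cong₂ _+_ (trans (∑-scale a≉0 (χ F) χ-cong) ∑-χ) ∑-χ)) (index y))
    where
    a≉0 : ¬ a ≈ 0#
    a≉0 a≈0 = ¬s (0# , ≈-trans (zeroˡ 0#) (≈-sym a≈0))
    f : Carrier → ℤ
    f y = χ F (a *ᶠ y) + χ F y
    f-cong : Congruent f
    f-cong x≈y = cong₂ _+_ (χ-cong (*-congˡ x≈y)) (χ-cong x≈y)
    f≤0 : ∀ y → f y ℤ.≤ 0ℤ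
    f≤0 y with classify y
    ... | zeroᶜ y≈0 e = ℤₚ.≤-reflexive (cong₂ _+_ (χ-zero (≈-trans (*-congˡ y≈0) (zeroʳ a))) e)
    ... | square r r≉0 r²≈y e = ℤₚ.≤-reflexive (cong₂ _+_ (trans (χ-cong (≈-trans (*-congˡ (≈-sym r²≈y)) (*-comm a _)))
          (trans (χ-square-* a r≉0) (χ-nonsquare ¬s))) e)
    -- For two nonsquares the product is still unknown. The bound `χ(ay) ≤ 1` suffices, and the
    -- vanishing sum forces equality.
    ... | nonsquare _ e = ℤₚ.+-mono-≤ (χ≤1 (a *ᶠ y)) (ℤₚ.≤-reflexive e)

  χ-* : ∀ x y → χ F (x *ᶠ y) ≡ χ F x * χ F y
  χ-* x y with classify x
  ... | zeroᶜ x≈0 e = trans (χ-zero (≈-trans (*-congʳ x≈0) (zeroˡ y))) (cong (_* χ F y) (sym e))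
  ... | square r r≉0 r²≈x e = trans (χ-cong (*-congʳ (≈-sym r²≈x))) (trans (χ-square-* y r≉0)
        (trans (sym (ℤₚ.*-identityˡ (χ F y))) (cong (_* χ F y) (sym e))))
  ... | nonsquare ¬s e = trans (negate (χ F (x *ᶠ y)) (χ F y) (nonsquare-* ¬s y)) (cong (_* χ F y) (sym e))
    where
    rearrange : ∀ u v → u ≡ (u + v) + -1ℤ * v
    rearrange = solve-∀
    negate : ∀ u v → u + v ≡ 0ℤ → u ≡ -1ℤ * v
    negate u v u+v≡0 = trans (rearrange u v) (trans (cong (_+ -1ℤ * v) u+v≡0) (ℤₚ.+-identityˡ _))

  -- The Jacobi sum of `χ` with itself, and `q` modulo 4.

  -1≉0 : ¬ -ᶠ 1# ≈ 0#
  -1≉0 e = 1≉0 (≈-trans (≈-sym (-‿involutive 1#)) (≈-trans (-‿cong e) -0#≈0#))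

  x-0 : ∀ x → x -ᶠ 0# ≈ x
  x-0 x = ≈-trans (+-congˡ -0#≈0#) (+-identityʳ x)

  -- For b, y ≉ 0 we have y (b - y) = y² (b / y - 1), and y ↦ b / y - 1 misses only -1.
  Jacobi : ∀ b → ∑ (λ y → χ F y * χ F (b -ᶠ y)) ≡ ε * (+ q * δ b 0# - 1ℤ)
  Jacobi b with toSum (b ≟ 0#)
  -- Here the summand is `χ(-1) χ(y)²`, which is `ε` everywhere except at `y = 0`.
  ... | inj₁ b≈0 = begin
    ∑ (λ y → χ F y * χ F (b -ᶠ y))             ≡⟨ ∑-cong pointwise ⟩
    ∑ (λ y → ε * 1ℤ + - ε * δ y 0#)            ≡⟨ ∑-lin ε (- ε) (λ _ → 1ℤ) (λ y → δ y 0#) ⟩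
    ε * ∑ (λ _ → 1ℤ) + - ε * ∑ (λ y → δ y 0#)  ≡⟨ cong₂ (λ u v → ε * u + - ε * v) ∑-1 (∑-δ-1 0#) ⟩
    ε * + q + - ε * 1ℤ                         ≡⟨ alg ε (+ q) ⟩
    ε * (+ q * 1ℤ - 1ℤ)                        ≡⟨ cong (λ u → ε * (+ q * u - 1ℤ)) (𝟙-yes (b ≟ 0#) b≈0) ⟨
    ε * (+ q * δ b 0# - 1ℤ)                    ∎
    where
    open ≡-Reasoning
    alg : ∀ e k → e * k + - e * 1ℤ ≡ e * (k * 1ℤ - 1ℤ)
    alg = solve-∀
    alg₁ : ∀ e k → k * (e * k) ≡ e * (k * k)
    alg₁ = solve-∀
    alg₂ : ∀ e → e * 1ℤ ≡ e * 1ℤ + - e * 0ℤ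
    alg₂ = solve-∀
    alg₃ : ∀ e → 0ℤ ≡ e * 1ℤ + - e * 1ℤ
    alg₃ = solve-∀
    b-y : ∀ y → b -ᶠ y ≈ -ᶠ 1# *ᶠ y
    b-y y = ≈-trans (+-congʳ b≈0) (≈-trans (+-identityˡ _) (≈-trans (-‿cong (≈-sym (*-identityˡ y))) (-‿distribˡ-* 1# y)))
    pointwise : ∀ y → χ F y * χ F (b -ᶠ y) ≡ ε * 1ℤ + - ε * δ y 0#
    pointwise y with toSum (y ≟ 0#)
    ... | inj₁ y≈0 = trans (cong (_* χ F (b -ᶠ y)) (χ-zero y≈0)) (trans (alg₃ ε) (cong (λ u → ε * 1ℤ + - ε * u) (sym (𝟙-yes (y ≟ 0#) y≈0))))
    ... | inj₂ y≉0 = begin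
      χ F y * χ F (b -ᶠ y)      ≡⟨ cong (χ F y *_) (trans (χ-cong (b-y y)) (χ-* (-ᶠ 1#) y)) ⟩
      χ F y * (ε * χ F y)       ≡⟨ alg₁ ε (χ F y) ⟩
      ε * (χ F y * χ F y)       ≡⟨ cong (ε *_) (χ² y≉0) ⟩
      ε * 1ℤ                    ≡⟨ alg₂ ε ⟩
      ε * 1ℤ + - ε * 0ℤ         ≡⟨ cong (λ u → ε * 1ℤ + - ε * u) (𝟙-no (y ≟ 0#) y≉0) ⟨
      ε * 1ℤ + - ε * δ y 0#     ∎
  ... | inj₂ b≉0 = begin
    ∑ (λ y → χ F y * χ F (b -ᶠ y))                   ≡⟨ ∑-cong pointwise ⟩
    ∑ (λ y → 1ℤ * g (inv y) + - ε * δ y 0#)          ≡⟨ ∑-lin 1ℤ (- ε) (g ∘ inv) (λ y → δ y 0#) ⟩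
    1ℤ * ∑ (g ∘ inv) + - ε * ∑ (λ y → δ y 0#)        ≡⟨ cong₂ (λ u v → 1ℤ * u + - ε * v) ∑g (∑-δ-1 0#) ⟩
    1ℤ * 0ℤ + - ε * 1ℤ                               ≡⟨ alg ε (+ q) ⟩
    ε * (+ q * 0ℤ - 1ℤ)                              ≡⟨ cong (λ u → ε * (+ q * u - 1ℤ)) (𝟙-no (b ≟ 0#) b≉0) ⟨
    ε * (+ q * δ b 0# - 1ℤ)                          ∎
    where
    open ≡-Reasoning
    g : Carrier → ℤ
    g z = χ F (b *ᶠ z -ᶠ 1#)
    g-cong : Congruent g
    g-cong x≈y = χ-cong (+-congʳ (*-congˡ x≈y))
    ∑g : ∑ (g ∘ inv) ≡ 0ℤ
    ∑g = trans (∑-inv g g-cong) (trans (∑-scale b≉0 (λ z → χ F (z -ᶠ 1#)) (λ e → χ-cong (+-congʳ e)))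
           (trans (∑-shift 1# (χ F) χ-cong) ∑-χ))
    alg : ∀ e k → 1ℤ * 0ℤ + - e * 1ℤ ≡ e * (k * 0ℤ - 1ℤ)
    alg = solve-∀
    alg₁ : ∀ k → k ≡ 1ℤ * k + - ε * 0ℤ
    alg₁ k = trans (sym (ℤₚ.*-identityˡ k)) (trans (sym (ℤₚ.+-identityʳ _)) (cong (_+_ (1ℤ * k)) (sym (ℤₚ.*-zeroʳ (- ε)))))
    alg₂ : ∀ e → 0ℤ ≡ 1ℤ * e + - e * 1ℤ
    alg₂ = solve-∀
    factor : ∀ {y} → ¬ y ≈ 0# → y *ᶠ (b -ᶠ y) ≈ (y *ᶠ y) *ᶠ (b *ᶠ inv y -ᶠ 1#)
    factor {y} y≉0 = ≈-trans (*-congˡ (≈-sym (≈-trans (x[y-z]≈xy-xz y _ _) (+-cong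
        (≈-trans (*-congˡ (*-comm b (inv y))) (≈-trans (≈-sym (*-assoc _ _ _)) (≈-trans (*-congʳ (inv-right y≉0)) (*-identityˡ b))))
        (-‿cong (*-identityʳ y)))))) (≈-sym (*-assoc _ _ _))
    pointwise : ∀ y → χ F y * χ F (b -ᶠ y) ≡ 1ℤ * g (inv y) + - ε * δ y 0#
    pointwise y with toSum (y ≟ 0#)
    -- As `inv 0 = 0`, the function `g ∘ inv` has the value `χ(-1) = ε` at 0, where the true summand
    -- is 0; the `δ` term removes it.
    ... | inj₁ y≈0 = trans (cong (_* χ F (b -ᶠ y)) (χ-zero y≈0)) (trans (alg₂ ε) (cong₂ (λ u v → 1ℤ * u + - ε * v)
          (χ-cong (≈-sym (≈-trans (+-congʳ (≈-trans (*-congˡ (inv-zero y≈0)) (zeroʳ b))) (+-identityˡ _))))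
          (sym (𝟙-yes (y ≟ 0#) y≈0))))
    ... | inj₂ y≉0 = trans (sym (χ-* y (b -ᶠ y))) (trans (χ-cong (factor y≉0)) (trans (χ-square-* _ y≉0)
          (trans (alg₁ (g (inv y))) (cong (λ u → 1ℤ * g (inv y) + - ε * u) (sym (𝟙-no (y ≟ 0#) y≉0))))))

  -- Modulo 4 only y = 0 and y = 1 contribute to ∑ (1 + χ(y)) (1 + χ(1 - y)) = q - χ(-1), and they contribute 2 each.
  4∣q-ε : + 4 ∣ + q - ε
  4∣q-ε = ∣m+n∣m⇒∣n {m = - + 4} {n = + q - ε} (subst (+ 4 ∣_) ∑-w (sum-∣ (w ∘ enum) (4∣w ∘ enum))) (divides -1ℤ refl)
    where
    t w : Carrier → ℤ
    -- `t` is the product `(1 + χ(y))(1 + χ(1 - y))`, expanded into the shape of `∑-lin`.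
    -- Subtracting 2 at 0 and at 1 leaves only multiples of 4, and changes the sum by 4.
    t y = 1ℤ * (1ℤ + χ F y) + 1ℤ * (χ F (1# -ᶠ y) + χ F y * χ F (1# -ᶠ y))
    w y = 1ℤ * t y + - + 2 * (δ y 0# + δ y 1#)
    ∑-t : ∑ t ≡ + q - ε
    ∑-t = begin
      ∑ t
        ≡⟨ ∑-lin 1ℤ 1ℤ (λ y → 1ℤ + χ F y) (λ y → χ F (1# -ᶠ y) + χ F y * χ F (1# -ᶠ y)) ⟩
      1ℤ * ∑ (λ y → 1ℤ + χ F y) + 1ℤ * ∑ (λ y → χ F (1# -ᶠ y) + χ F y * χ F (1# -ᶠ y))
        ≡⟨ cong₂ (λ u v → 1ℤ * u + 1ℤ * v)
             (trans (∑-+ (λ _ → 1ℤ) (χ F)) (cong₂ _+_ ∑-1 ∑-χ))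
             (trans (∑-+ (λ y → χ F (1# -ᶠ y)) (λ y → χ F y * χ F (1# -ᶠ y)))
                    (cong₂ _+_ (trans (∑-reflect 1# (χ F) χ-cong) ∑-χ)
                               (trans (Jacobi 1#) (cong (λ u → ε * (+ q * u - 1ℤ)) (𝟙-no (1# ≟ 0#) 1≉0))))) ⟩
      1ℤ * (+ q + 0ℤ) + 1ℤ * (0ℤ + ε * (+ q * 0ℤ - 1ℤ))
        ≡⟨ alg (+ q) ε ⟩
      + q - ε ∎
      where
      open ≡-Reasoning
      alg : ∀ k e → 1ℤ * (k + 0ℤ) + 1ℤ * (0ℤ + e * (k * 0ℤ - 1ℤ)) ≡ k - e
      alg = solve-∀
    ∑-w : ∑ w ≡ - + 4 + (+ q - ε)
    ∑-w = trans (∑-lin 1ℤ (- + 2) t (λ y → δ y 0# + δ y 1#))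
      (trans (cong₂ (λ u v → 1ℤ * u + - + 2 * v) ∑-t (trans (∑-+ (λ y → δ y 0#) (λ y → δ y 1#)) (cong₂ _+_ (∑-δ-1 0#) (∑-δ-1 1#))))
             (alg (+ q - ε)))
      where
      alg : ∀ k → 1ℤ * k + - + 2 * (1ℤ + 1ℤ) ≡ - + 4 + k
      alg = solve-∀
    value : ∀ y {x z i j} → χ F y ≡ x → χ F (1# -ᶠ y) ≡ z → δ y 0# ≡ i → δ y 1# ≡ j →
      + 4 ∣ 1ℤ * (1ℤ * (1ℤ + x) + 1ℤ * (z + x * z)) + - + 2 * (i + j) → + 4 ∣ w y
    value y refl refl refl refl 4∣ = 4∣
    χ-1 : ∀ {x} → x ≈ 1# → χ F x ≡ 1ℤ
    χ-1 x≈1 = χ-square (λ x≈0 → 1≉0 (≈-trans (≈-sym x≈1) x≈0)) (1# , ≈-trans (*-identityˡ 1#) (≈-sym x≈1))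
    4∣w : ∀ y → + 4 ∣ w y
    4∣w y with toSum (y ≟ 0#) | toSum (y ≟ 1#)
    ... | inj₁ y≈0 | _ = value y (χ-zero y≈0) (χ-1 (≈-trans (-‿congˡ y≈0) (x-0 1#))) (𝟙-yes (y ≟ 0#) y≈0)
          (𝟙-no (y ≟ 1#) (λ y≈1 → 1≉0 (≈-trans (≈-sym y≈1) y≈0))) (divides 0ℤ refl)
    ... | inj₂ y≉0 | inj₁ y≈1 = value y (χ-1 y≈1) (χ-zero (≈-trans (-‿congˡ y≈1) (-‿inverseʳ 1#))) (𝟙-no (y ≟ 0#) y≉0)
          (𝟙-yes (y ≟ 1#) y≈1) (divides 0ℤ refl)
    ... | inj₂ y≉0 | inj₂ y≉1 with χ-± y≉0 | χ-± {1# -ᶠ y} (λ e → y≉1 (≈-sym (x∙y⁻¹≈ε⇒x≈y 1# y e)))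
    ...   | inj₁ e | inj₁ e′ = value y e e′ (𝟙-no (y ≟ 0#) y≉0) (𝟙-no (y ≟ 1#) y≉1) (divides 1ℤ refl)
    ...   | inj₁ e | inj₂ e′ = value y e e′ (𝟙-no (y ≟ 0#) y≉0) (𝟙-no (y ≟ 1#) y≉1) (divides 0ℤ refl)
    ...   | inj₂ e | inj₁ e′ = value y e e′ (𝟙-no (y ≟ 0#) y≉0) (𝟙-no (y ≟ 1#) y≉1) (divides 0ℤ refl)
    ...   | inj₂ e | inj₂ e′ = value y e e′ (𝟙-no (y ≟ 0#) y≉0) (𝟙-no (y ≟ 1#) y≉1) (divides 0ℤ refl)

  -- The kernel of one variable and convolution with it.

  K : Carrier → Carrier → ℤ
  K a y = (1ℤ + χ F a * χ F y) - δ y 0#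

  -- Over all `x` this counts the square roots of `y / a`, and `χ(y / a) = χ(a) χ(y)` because
  -- `χ(a)² = 1`. The excluded root `x = 0` occurs exactly for `y = 0`.
  count-a√ : ∀ {a} → ¬ a ≈ 0# → ∀ y → ∑ (λ x → (1ℤ - δ x 0#) * δ (a *ᶠ (x *ᶠ x)) y) ≡ K a y
  count-a√ {a} a≉0 y = begin
    ∑ (λ x → (1ℤ - δ x 0#) * δ (a *ᶠ (x *ᶠ x)) y)
      ≡⟨ ∑-cong (λ x → alg (δ x 0#) (δ (a *ᶠ (x *ᶠ x)) y)) ⟩
    ∑ (λ x → 1ℤ * δ (a *ᶠ (x *ᶠ x)) y + -1ℤ * (δ x 0# * δ (a *ᶠ (x *ᶠ x)) y))
      ≡⟨ ∑-lin 1ℤ -1ℤ (λ x → δ (a *ᶠ (x *ᶠ x)) y) (λ x → δ x 0# * δ (a *ᶠ (x *ᶠ x)) y) ⟩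
    1ℤ * ∑ (λ x → δ (a *ᶠ (x *ᶠ x)) y) + -1ℤ * ∑ (λ x → δ x 0# * δ (a *ᶠ (x *ᶠ x)) y)
      ≡⟨ cong₂ (λ u v → 1ℤ * u + -1ℤ * v)
           (trans (∑-cong (λ x → 𝟙-⇔ (_ ≟ y) ((x *ᶠ x) ≟ (inv a *ᶠ y)) solve unsolve)) (count-√ (inv a *ᶠ y)))
           (∑-δ 0# (λ x → δ (a *ᶠ (x *ᶠ x)) y) (λ e → δ-cong (*-congˡ (*-cong e e)) ≈-refl)) ⟩
    1ℤ * (1ℤ + χ F (inv a *ᶠ y)) + -1ℤ * δ (a *ᶠ (0# *ᶠ 0#)) y
      ≡⟨ cong₂ (λ u v → 1ℤ * (1ℤ + u) + -1ℤ * v) χ-quotient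
           (trans (δ-cong (≈-trans (*-congˡ (zeroˡ 0#)) (zeroʳ a)) ≈-refl) (δ-sym 0# y)) ⟩
    1ℤ * (1ℤ + χ F a * χ F y) + -1ℤ * δ y 0#
      ≡⟨ alg′ (1ℤ + χ F a * χ F y) (δ y 0#) ⟩
    K a y ∎
    where
    open ≡-Reasoning
    alg : ∀ i j → (1ℤ - i) * j ≡ 1ℤ * j + -1ℤ * (i * j)
    alg = solve-∀
    alg′ : ∀ i j → 1ℤ * i + -1ℤ * j ≡ i - j
    alg′ = solve-∀
    alg″ : ∀ i j → i * (i * j) ≡ (i * i) * j
    alg″ = solve-∀
    a*inv-a* : ∀ z → a *ᶠ (inv a *ᶠ z) ≈ z
    a*inv-a* z = ≈-trans (≈-sym (*-assoc _ _ _)) (≈-trans (*-congʳ (inv-right a≉0)) (*-identityˡ z))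
    solve : ∀ {z} → a *ᶠ z ≈ y → z ≈ inv a *ᶠ y
    solve az≈y = *-cancelˡ-nonZero a≉0 (≈-trans az≈y (≈-sym (a*inv-a* y)))
    unsolve : ∀ {z} → z ≈ inv a *ᶠ y → a *ᶠ z ≈ y
    unsolve z≈ = ≈-trans (*-congˡ z≈) (a*inv-a* y)
    χ-quotient : χ F (inv a *ᶠ y) ≡ χ F a * χ F y
    χ-quotient = sym (begin
      χ F a * χ F y                          ≡⟨ cong (χ F a *_) (trans (χ-cong (≈-sym (a*inv-a* y))) (χ-* a (inv a *ᶠ y))) ⟩
      χ F a * (χ F a * χ F (inv a *ᶠ y))     ≡⟨ alg″ (χ F a) _ ⟩
      χ F a * χ F a * χ F (inv a *ᶠ y)       ≡⟨ cong (_* χ F (inv a *ᶠ y)) (χ² a≉0) ⟩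
      1ℤ * χ F (inv a *ᶠ y)                  ≡⟨ ℤₚ.*-identityˡ _ ⟩
      χ F (inv a *ᶠ y)                       ∎)

  -- Writing `g(a x²)` as a sum of `δ(a x², y) g(y)` over `y` and exchanging the sums groups the `x`
  -- by the value of `a x²`.
  ∑-substitute : ∀ {a} → ¬ a ≈ 0# → ∀ g → Congruent g →
    ∑ (λ x → (1ℤ - δ x 0#) * g (a *ᶠ (x *ᶠ x))) ≡ ∑ (λ y → g y * K a y)
  ∑-substitute {a} a≉0 g g-cong = begin
    ∑ (λ x → (1ℤ - δ x 0#) * g (a *ᶠ (x *ᶠ x)))
      ≡⟨ ∑-cong (λ x → cong ((1ℤ - δ x 0#) *_) (sym (trans (∑-cong (λ y → cong (_* g y) (δ-sym (a *ᶠ (x *ᶠ x)) y))) (∑-δ (a *ᶠ (x *ᶠ x)) g g-cong)))) ⟩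
    ∑ (λ x → (1ℤ - δ x 0#) * ∑ (λ y → δ (a *ᶠ (x *ᶠ x)) y * g y))
      ≡⟨ ∑-cong (λ x → trans (sym (∑-*ˡ (1ℤ - δ x 0#) (λ y → δ (a *ᶠ (x *ᶠ x)) y * g y)))
                              (∑-cong (λ y → alg (1ℤ - δ x 0#) (δ (a *ᶠ (x *ᶠ x)) y) (g y)))) ⟩
    ∑ (λ x → ∑ (λ y → g y * ((1ℤ - δ x 0#) * δ (a *ᶠ (x *ᶠ x)) y)))
      ≡⟨ ∑-swap (λ x y → g y * ((1ℤ - δ x 0#) * δ (a *ᶠ (x *ᶠ x)) y)) ⟩
    ∑ (λ y → ∑ (λ x → g y * ((1ℤ - δ x 0#) * δ (a *ᶠ (x *ᶠ x)) y)))
      ≡⟨ ∑-cong (λ y → trans (∑-*ˡ (g y) (λ x → (1ℤ - δ x 0#) * δ (a *ᶠ (x *ᶠ x)) y)) (cong (g y *_) (count-a√ a≉0 y))) ⟩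
    ∑ (λ y → g y * K a y) ∎
    where
    open ≡-Reasoning
    alg : ∀ i j k → i * (j * k) ≡ k * (i * j)
    alg = solve-∀

  ∑-*K : ∀ a g → Congruent g → ∑ (λ y → g y * K a y) ≡ (∑ g + χ F a * ∑ (λ y → χ F y * g y)) - g 0#
  ∑-*K a g g-cong = begin
    ∑ (λ y → g y * K a y)
      ≡⟨ ∑-cong (λ y → alg (g y) (χ F a) (χ F y) (δ y 0#)) ⟩
    ∑ (λ y → 1ℤ * (g y + χ F a * (χ F y * g y)) + -1ℤ * (δ y 0# * g y))
      ≡⟨ ∑-lin 1ℤ -1ℤ (λ y → g y + χ F a * (χ F y * g y)) (λ y → δ y 0# * g y) ⟩
    1ℤ * ∑ (λ y → g y + χ F a * (χ F y * g y)) + -1ℤ * ∑ (λ y → δ y 0# * g y)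
      ≡⟨ cong₂ (λ u v → 1ℤ * u + -1ℤ * v)
           (trans (∑-+ g (λ y → χ F a * (χ F y * g y))) (cong (_+_ (∑ g)) (∑-*ˡ (χ F a) (λ y → χ F y * g y))))
           (∑-δ 0# g g-cong) ⟩
    1ℤ * (∑ g + χ F a * ∑ (λ y → χ F y * g y)) + -1ℤ * g 0#
      ≡⟨ alg′ (∑ g + χ F a * ∑ (λ y → χ F y * g y)) (g 0#) ⟩
    (∑ g + χ F a * ∑ (λ y → χ F y * g y)) - g 0# ∎
    where
    open ≡-Reasoning
    alg : ∀ k e f i → k * ((1ℤ + e * f) - i) ≡ 1ℤ * (k + e * (f * k)) + -1ℤ * (i * k)
    alg = solve-∀
    alg′ : ∀ i j → 1ℤ * i + -1ℤ * j ≡ i - j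
    alg′ = solve-∀

  -- The value at b of the convolution of K a with A + B δ₀ + C χ.
  convolve : ∀ a b A B C →
    ∑ (λ y → (A + (B * δ (b -ᶠ y) 0# + C * χ F (b -ᶠ y))) * K a y)
      ≡ A * (+ q - 1ℤ) + B * K a b + C * (χ F a * (ε * (+ q * δ b 0# - 1ℤ)) - χ F b)
  convolve a b A B C = begin
    ∑ (λ y → (A + (B * δ (b -ᶠ y) 0# + C * χ F (b -ᶠ y))) * K a y)
      ≡⟨ ∑-cong (λ y → alg A B C (δ (b -ᶠ y) 0#) (χ F (b -ᶠ y)) (K a y)) ⟩
    ∑ (λ y → A * (1ℤ * K a y) + 1ℤ * (B * (δ (b -ᶠ y) 0# * K a y) + C * (χ F (b -ᶠ y) * K a y)))
      ≡⟨ ∑-lin A 1ℤ (λ y → 1ℤ * K a y) (λ y → B * (δ (b -ᶠ y) 0# * K a y) + C * (χ F (b -ᶠ y) * K a y)) ⟩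
    A * ∑ (λ y → 1ℤ * K a y) + 1ℤ * ∑ (λ y → B * (δ (b -ᶠ y) 0# * K a y) + C * (χ F (b -ᶠ y) * K a y))
      ≡⟨ cong₂ (λ u v → A * u + 1ℤ * v) ∑-K
           (trans (∑-lin B C (λ y → δ (b -ᶠ y) 0# * K a y) (λ y → χ F (b -ᶠ y) * K a y))
             (cong₂ (λ u v → B * u + C * v) ∑-δK ∑-χK)) ⟩
    A * (+ q - 1ℤ) + 1ℤ * (B * K a b + C * (χ F a * (ε * (+ q * δ b 0# - 1ℤ)) - χ F b))
      ≡⟨ alg′ (A * (+ q - 1ℤ)) (B * K a b) (C * (χ F a * (ε * (+ q * δ b 0# - 1ℤ)) - χ F b)) ⟩
    A * (+ q - 1ℤ) + B * K a b + C * (χ F a * (ε * (+ q * δ b 0# - 1ℤ)) - χ F b) ∎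
    where
    open ≡-Reasoning
    alg : ∀ A B C i j k → (A + (B * i + C * j)) * k ≡ A * (1ℤ * k) + 1ℤ * (B * (i * k) + C * (j * k))
    alg = solve-∀
    alg′ : ∀ i j k → i + 1ℤ * (j + k) ≡ i + j + k
    alg′ = solve-∀
    alg″ : ∀ i k → i + k * 0ℤ - 1ℤ ≡ i - 1ℤ
    alg″ = solve-∀
    alg‴ : ∀ i j k → 0ℤ + i * j - k ≡ i * j - k
    alg‴ = solve-∀
    K-cong : Congruent (K a)
    K-cong e = cong₂ (λ u v → (1ℤ + χ F a * u) - v) (χ-cong e) (δ-cong e ≈-refl)
    ∑-K : ∑ (λ y → 1ℤ * K a y) ≡ + q - 1ℤ
    ∑-K = trans (∑-*K a (λ _ → 1ℤ) (λ _ → refl))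
      (trans (cong₂ (λ u v → u + χ F a * v - 1ℤ) ∑-1 (trans (∑-cong (λ y → ℤₚ.*-identityʳ (χ F y))) ∑-χ)) (alg″ (+ q) (χ F a)))
    ∑-δK : ∑ (λ y → δ (b -ᶠ y) 0# * K a y) ≡ K a b
    ∑-δK = trans (∑-cong (λ y → cong (_* K a y) (𝟙-⇔ ((b -ᶠ y) ≟ 0#) (y ≟ b)
             (λ e → ≈-sym (x∙y⁻¹≈ε⇒x≈y b y e)) (λ e → ≈-trans (-‿congˡ e) (-‿inverseʳ b))))) (∑-δ b (K a) K-cong)
    -- The product `χ * χ` arises only here; `Jacobi` evaluates it and brings in `ε`.
    ∑-χK : ∑ (λ y → χ F (b -ᶠ y) * K a y) ≡ χ F a * (ε * (+ q * δ b 0# - 1ℤ)) - χ F b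
    ∑-χK = trans (∑-*K a (λ y → χ F (b -ᶠ y)) (λ e → χ-cong (-‿congˡ e)))
      (trans (cong₂ (λ u v → u - v) (cong₂ (λ u v → u + χ F a * v) (trans (∑-reflect b (χ F) χ-cong) ∑-χ) (Jacobi b)) (χ-cong (x-0 b)))
        (alg‴ (χ F a) (ε * (+ q * δ b 0# - 1ℤ)) (χ F b)))

-- Counting in lists, and recursions for `Nstar` and `mCount`.

count : ∀ {a} {A : Set a} → (A → Bool) → List A → ℕ
count p xs = length (filterᵇ p xs)

count-cong : ∀ {a} {A : Set a} {p r : A → Bool} → (∀ x → p x ≡ r x) → ∀ xs → count p xs ≡ count r xs
count-cong p≡r [] = refl
count-cong {p = p} {r} p≡r (x ∷ xs) rewrite p≡r x with r x
... | true  = cong ℕ.suc (count-cong p≡r xs)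
... | false = count-cong p≡r xs

count-false : ∀ {a} {A : Set a} (xs : List A) → count (λ _ → false) xs ≡ 0
count-false []       = refl
count-false (_ ∷ xs) = count-false xs

count-map : ∀ {a b} {A : Set a} {B : Set b} (p : B → Bool) (f : A → B) xs → count p (map f xs) ≡ count (p ∘ f) xs
count-map p f [] = refl
count-map p f (x ∷ xs) with p (f x)
... | true  = cong ℕ.suc (count-map p f xs)
... | false = count-map p f xs

count-++ : ∀ {a} {A : Set a} (p : A → Bool) xs ys → count p (xs ++ ys) ≡ count p xs ℕ.+ count p ys
count-++ p xs ys = trans (cong length (filter-++ (T? ∘ p) xs ys)) (length-++ (filterᵇ p xs))

count-concatMap-tabulate : ∀ {a b} {A : Set a} {B : Set b} {n} (p : B → Bool) (f : A → List B) (g : Fin n → A) →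
  + count p (concatMap f (tabulate g)) ≡ sum (λ i → + count p (f (g i)))
count-concatMap-tabulate {n = ℕ.zero}  p f g = refl
count-concatMap-tabulate {n = ℕ.suc n} p f g =
  trans (cong +_ (count-++ p (f (g zero)) (concatMap f (tabulate (g ∘ suc)))))
        (cong (_+_ (+ count p (f (g zero)))) (count-concatMap-tabulate p f (g ∘ suc)))

tabulate-suc : ∀ n → tabulate {n = n} suc ≡ map suc (allFin n)
tabulate-suc n = sym (map-tabulate (λ i → i) suc)

all-allFin-suc : ∀ {n} (p : Fin (ℕ.suc n) → Bool) → all p (allFin (ℕ.suc n)) ≡ p zero ∧ all (p ∘ suc) (allFin n)
all-allFin-suc {n} p = cong (λ bs → p zero ∧ and bs) (trans (map-tabulate suc p) (sym (map-tabulate (λ i → i) (p ∘ suc))))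

module _ {c ℓ : Level} {q : ℕ} (F : FiniteField c ℓ q) where

  open FieldSums F
  open FiniteField F hiding (zero)
    renaming ( _+_ to _+ᶠ_; _*_ to _*ᶠ_; -_ to -ᶠ_; _-_ to _-ᶠ_; refl to ≈-refl; sym to ≈-sym; trans to ≈-trans )

  -- Fixing the first coordinate `x` moves its term to the right-hand side of the equation; the
  -- factor `1 - δ x 0#` encodes `x ≠ 0`.
  Nstar-suc : ∀ n a b →
    + Nstar F (ℕ.suc n) a b ≡ ∑ (λ x → (1ℤ - δ x 0#) * + Nstar F n (a ∘ suc) (b -ᶠ a zero *ᶠ (x *ᶠ x)))
  Nstar-suc n a b = trans (count-concatMap-tabulate {n = q} _ (λ i → map (i ∷_) (allTuples F n)) (λ i → i))
    (sum-cong-≗ (λ i → trans (cong +_ (count-map _ (i ∷_) (allTuples F n))) (first i)))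
    where
    -- The test in `Nstar` is local to its definition, so it is spelled out again here, once for `n`
    -- and once for `suc n` variables; each agrees with the original by computation.
    tail-good : Carrier → Vec (Fin q) n → Bool
    tail-good b v = all (λ j → not (isZeroᵇ F (enum (lookup v j)))) (allFin n)
      ∧ does (sumF F n (λ j → a (suc j) *ᶠ (enum (lookup v j) *ᶠ enum (lookup v j))) ≟ b)
    head-good : Fin q → Vec (Fin q) n → Bool
    head-good i v = not (isZeroᵇ F (enum i)) ∧ tail-good (b -ᶠ a zero *ᶠ (enum i *ᶠ enum i)) v
    good : Vec (Fin q) (ℕ.suc n) → Bool
    good v = all (λ j → not (isZeroᵇ F (enum (lookup v j)))) (allFin (ℕ.suc n))
      ∧ does (sumF F (ℕ.suc n) (λ j → a j *ᶠ (enum (lookup v j) *ᶠ enum (lookup v j))) ≟ b)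
    good-∷ : ∀ i v → good (i ∷ v) ≡ head-good i v
    good-∷ i v = trans
      (cong₂ _∧_ (all-allFin-suc (λ j → not (isZeroᵇ F (enum (lookup (i ∷ v) j)))))
        (does-⇔ (mk⇔ (λ e → ≈-trans (≈-sym (x+y-y _ _)) (+-congʳ (≈-trans (+-comm _ _) e)))
                     (λ e → ≈-trans (+-comm _ _) (≈-trans (+-congʳ e) (x-y+y _ _)))) (_ ≟ _) (_ ≟ _)))
      (∧-assoc (not (isZeroᵇ F (enum i))) _ _)
    first : ∀ i → + count (good ∘ (i ∷_)) (allTuples F n)
      ≡ (1ℤ - δ (enum i) 0#) * + Nstar F n (a ∘ suc) (b -ᶠ a zero *ᶠ (enum i *ᶠ enum i))
    first i = trans (cong +_ (count-cong (good-∷ i) (allTuples F n))) (by-head (does (enum i ≟ 0#)))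
      where
      by-head : ∀ z → + count (λ v → not z ∧ tail-good (b -ᶠ a zero *ᶠ (enum i *ᶠ enum i)) v) (allTuples F n)
        ≡ (1ℤ - (if z then 1ℤ else 0ℤ)) * + Nstar F n (a ∘ suc) (b -ᶠ a zero *ᶠ (enum i *ᶠ enum i))
      by-head true  = cong +_ (count-false (allTuples F n))
      by-head false = sym (ℤₚ.*-identityˡ _)

  mCount-suc : ∀ n a b → mCount F (ℕ.suc n) a b
    ≡ (if does (χ F (a zero) ℤ.≟ χ F b) then 1 else 0) ℕ.+ mCount F n (a ∘ suc) b
  mCount-suc n a b with does (χ F (a zero) ℤ.≟ χ F b)
                      | trans (cong (count p) (tabulate-suc n)) (count-map p suc (allFin n))
    where
    p : Fin (ℕ.suc n) → Bool
    p i = does (χ F (a i) ℤ.≟ χ F b)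
  ... | true  | e = cong ℕ.suc e
  ... | false | e = e

  -- This makes the truncated exponent `n ∸ mCount F n a b` a true difference, so that it grows with
  -- `n` when the new coefficient is not counted.
  mCount≤n : ∀ n a b → mCount F n a b ℕ.≤ n
  mCount≤n n a b = subst (mCount F n a b ℕ.≤_) (length-tabulate (λ i → i))
    (length-filter (T? ∘ λ i → does (χ F (a i) ℤ.≟ χ F b)) (allFin n))

-- Arithmetic and conjugation in ℤ[√d].

module _ (d : ℤ) where

  infixl 7 _⊛_

  _⊛_ : ℤ[√ d ] → ℤ[√ d ] → ℤ[√ d ]
  _⊛_ = _⊗_ d

  conj : ℤ[√ d ] → ℤ[√ d ]
  conj (x , y) = (x , - y)

  ⊗-assoc : ∀ z w t → (z ⊛ w) ⊛ t ≡ z ⊛ (w ⊛ t)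
  ⊗-assoc (x , y) (x′ , y′) (x″ , y″) = cong₂ _,_ (re d x y x′ y′ x″ y″) (im d x y x′ y′ x″ y″)
    where
    re : ∀ d x y x′ y′ x″ y″ → (x * x′ + d * (y * y′)) * x″ + d * ((x * y′ + y * x′) * y″)
      ≡ x * (x′ * x″ + d * (y′ * y″)) + d * (y * (x′ * y″ + y′ * x″))
    re = solve-∀
    im : ∀ d x y x′ y′ x″ y″ → (x * x′ + d * (y * y′)) * y″ + (x * y′ + y * x′) * x″
      ≡ x * (x′ * y″ + y′ * x″) + y * (x′ * x″ + d * (y′ * y″))
    im = solve-∀

  ⊗-comm : ∀ z w → z ⊛ w ≡ w ⊛ z
  ⊗-comm (x , y) (x′ , y′) = cong₂ _,_ (re d x y x′ y′) (im x y x′ y′)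
    where
    re : ∀ d x y x′ y′ → x * x′ + d * (y * y′) ≡ x′ * x + d * (y′ * y)
    re = solve-∀
    im : ∀ x y x′ y′ → x * y′ + y * x′ ≡ x′ * y + y′ * x
    im = solve-∀

  ⊗-leftComm : ∀ z w t → z ⊛ (w ⊛ t) ≡ w ⊛ (z ⊛ t)
  ⊗-leftComm z w t = trans (sym (⊗-assoc z w t)) (trans (cong (_⊛ t) (⊗-comm z w)) (⊗-assoc w z t))

  conj-⊗ : ∀ z w → conj z ⊛ conj w ≡ conj (z ⊛ w)
  conj-⊗ (x , y) (x′ , y′) = cong₂ _,_ (re d x y x′ y′) (im x y x′ y′)
    where
    re : ∀ d x y x′ y′ → x * x′ + d * (- y * - y′) ≡ x * x′ + d * (y * y′)
    re = solve-∀
    im : ∀ x y x′ y′ → x * - y′ + - y * x′ ≡ - (x * y′ + y * x′)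
    im = solve-∀

  conj-^ : ∀ z k → _^'_ d (conj z) k ≡ conj (_^'_ d z k)
  conj-^ z ℕ.zero    = refl
  conj-^ z (ℕ.suc k) = trans (cong (conj z ⊛_) (conj-^ z k)) (conj-⊗ z (_^'_ d z k))

  conj-^⊗^ : ∀ z w k l → _^'_ d (conj z) k ⊛ _^'_ d (conj w) l ≡ conj (_^'_ d z k ⊛ _^'_ d w l)
  conj-^⊗^ z w k l = trans (cong₂ _⊛_ (conj-^ z k) (conj-^ w l)) (conj-⊗ (_^'_ d z k) (_^'_ d w l))

  trace : ∀ z → _⊕_ d z (conj z) ≡ (+ 2 * proj₁ z , 0ℤ)
  trace (x , y) = cong₂ _,_ (double x) (ℤₚ.+-inverseʳ y)
    where
    double : ∀ x → x + x ≡ + 2 * x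
    double = solve-∀

  ⊕-comm : ∀ z w → _⊕_ d z w ≡ _⊕_ d w z
  ⊕-comm (x , y) (x′ , y′) = cong₂ _,_ (ℤₚ.+-comm x x′) (ℤₚ.+-comm y y′)


pos-^ : ∀ m n → + (m ^ n) ≡ (+ m) ℤ.^ n
pos-^ m ℕ.zero    = refl
pos-^ m (ℕ.suc n) = trans (ℤₚ.pos-* m (m ^ n)) (cong (+ m *_) (pos-^ m n))

-- The closed form of `q N*` for every right-hand side.

module Counting {c ℓ : Level} {q : ℕ} (F : FiniteField c ℓ q) (q-odd : q % 2 ≡ 1) where

  open FieldSums F
  open QuadraticCharacter F q-odd
  open FiniteField F hiding (zero)
    renaming ( _+_ to _+ᶠ_; _*_ to _*ᶠ_; -_ to -ᶠ_; _-_ to _-ᶠ_; refl to ≈-refl; sym to ≈-sym; trans to ≈-trans )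

  d : ℤ
  d = ε * + q

  -- ∏ (1 - χ(aᵢ) √d); √d plays the role of χ, whose convolution square is d δ modulo constants.
  charProduct : ∀ n → (Fin n → Carrier) → ℤ[√ d ]
  charProduct ℕ.zero    a = (1ℤ , 0ℤ)
  charProduct (ℕ.suc n) a = _⊗_ d (1ℤ , - χ F (a zero)) (charProduct n (a ∘ suc))

  -- The basis elements 1 and √d stand for `q δ₀ - 1` and `q χ`; the scaling by `q` keeps all
  -- coefficients integral.
  Nformula : ∀ n → (Fin n → Carrier) → Carrier → ℤ
  Nformula n a b = (+ q - 1ℤ) ℤ.^ n
    + -1ℤ ℤ.^ n * (proj₁ (charProduct n a) * (+ q * δ b 0# - 1ℤ) + + q * (proj₂ (charProduct n a) * χ F b))

  -- The recursion passes from `b` to all `b - a₀ x²`, which may be 0. Hence the induction covers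
  -- every `b` and keeps the `δ` term.
  q*Nstar : ∀ n a → (∀ i → ¬ a i ≈ 0#) → ∀ b → + q * + Nstar F n a b ≡ Nformula n a b
  q*Nstar ℕ.zero a a≉0 b = trans (cong (+ q *_) base) (alg (+ q) (δ b 0#))
    where
    alg : ∀ k i → k * i ≡ 1ℤ + 1ℤ * (1ℤ * (k * i - 1ℤ) + k * 0ℤ)
    alg = solve-∀
    base : + Nstar F 0 a b ≡ δ b 0#
    base with does (0# ≟ b) | δ-sym 0# b
    ... | true  | e = e
    ... | false | e = e
  q*Nstar (ℕ.suc n) a a≉0 b = begin
    + q * + Nstar F (ℕ.suc n) a b
      ≡⟨ cong (+ q *_) (Nstar-suc F n a b) ⟩
    + q * ∑ (λ x → (1ℤ - δ x 0#) * + Nstar F n a′ (b -ᶠ a zero *ᶠ (x *ᶠ x)))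
      ≡⟨ ∑-*ˡ (+ q) (λ x → (1ℤ - δ x 0#) * + Nstar F n a′ (b -ᶠ a zero *ᶠ (x *ᶠ x))) ⟨
    ∑ (λ x → + q * ((1ℤ - δ x 0#) * + Nstar F n a′ (b -ᶠ a zero *ᶠ (x *ᶠ x))))
      ≡⟨ ∑-cong (λ x → trans (swap (+ q) (1ℤ - δ x 0#) (+ Nstar F n a′ (b -ᶠ a zero *ᶠ (x *ᶠ x))))
           (cong ((1ℤ - δ x 0#) *_) (trans (q*Nstar n a′ (a≉0 ∘ suc) (b -ᶠ a zero *ᶠ (x *ᶠ x))) (split P S u (+ q) _ v _)))) ⟩
    ∑ (λ x → (1ℤ - δ x 0#) * g (a zero *ᶠ (x *ᶠ x)))
      ≡⟨ ∑-substitute (a≉0 zero) g (λ e → cong₂ (λ i j → A + (B * i + C * j)) (δ-cong (-‿congˡ e) ≈-refl) (χ-cong (-‿congˡ e))) ⟩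
    ∑ (λ y → g y * K (a zero) y)
      ≡⟨ convolve (a zero) b A B C ⟩
    A * (+ q - 1ℤ) + B * K (a zero) b + C * (χ F (a zero) * (ε * (+ q * δ b 0# - 1ℤ)) - χ F b)
      ≡⟨ collect P S u v (+ q) ε (χ F (a zero)) (χ F b) (δ b 0#) ⟩
    Nformula (ℕ.suc n) a b ∎
    where
    open ≡-Reasoning
    a′ = a ∘ suc
    u = proj₁ (charProduct n a′)
    v = proj₂ (charProduct n a′)
    P = (+ q - 1ℤ) ℤ.^ n
    S = -1ℤ ℤ.^ n
    -- `A`, `B`, `C` are the coordinates of `+ q * + Nstar F n a′` with respect to 1, `δ₀` and `χ`;
    -- the `- 1` of `q δ₀ - 1` goes into `A`.
    A = P - S * u
    B = S * u * + q
    C = S * v * + q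
    g : Carrier → ℤ
    g y = A + (B * δ (b -ᶠ y) 0# + C * χ F (b -ᶠ y))
    swap : ∀ i j k → i * (j * k) ≡ j * (i * k)
    swap = solve-∀
    split : ∀ P S u k i v e → P + S * (u * (k * i - 1ℤ) + k * (v * e)) ≡ (P - S * u) + (S * u * k * i + S * v * k * e)
    split = solve-∀
    -- Convolution with the kernel multiplies `u + v√d` by `-(1 - x√d)`, where `d = e k`; the minus
    -- sign joins the power of -1.
    collect : ∀ P S u v k e x y i →
      (P - S * u) * (k - 1ℤ) + S * u * k * ((1ℤ + x * y) - i) + S * v * k * (x * (e * (k * i - 1ℤ)) - y)
      ≡ (k - 1ℤ) * P + -1ℤ * S * ((1ℤ * u + e * k * (- x * v)) * (k * i - 1ℤ) + k * ((1ℤ * v + - x * u) * y))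
    collect = solve-∀

  -- Each `χ(aᵢ)` is `χ(b)` or `-χ(b)`, so only two different factors occur, and `mCount` counts the
  -- first kind.
  charProduct-powers : ∀ n a → (∀ i → ¬ a i ≈ 0#) → ∀ b → ¬ b ≈ 0# →
    charProduct n a ≡ _⊗_ d (_^'_ d (1ℤ , - χ F b) (mCount F n a b)) (_^'_ d (1ℤ , χ F b) (n ∸ mCount F n a b))
  charProduct-powers ℕ.zero a a≉0 b b≉0 = cong₂ _,_ (alg d) refl
    where
    alg : ∀ d → 1ℤ ≡ 1ℤ + d * 0ℤ
    alg = solve-∀
  charProduct-powers (ℕ.suc n) a a≉0 b b≉0
    rewrite mCount-suc F n a b | charProduct-powers n (a ∘ suc) (a≉0 ∘ suc) b b≉0 with χ F (a zero) ℤ.≟ χ F b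
  ... | yes e rewrite e = sym (⊗-assoc d (1ℤ , - χ F b) (_^'_ d (1ℤ , - χ F b) m) (_^'_ d (1ℤ , χ F b) (n ∸ m)))
    where m = mCount F n (a ∘ suc) b
  ... | no ¬e rewrite ℕₚ.+-∸-assoc 1 (mCount≤n F n (a ∘ suc) b) | χ-opposite (a≉0 zero) b≉0 ¬e =
      ⊗-leftComm d (1ℤ , χ F b) (_^'_ d (1ℤ , - χ F b) m) (_^'_ d (1ℤ , χ F b) (n ∸ m))
    where m = mCount F n (a ∘ suc) b

-- From the closed form to sums of conjugate powers.

module _ (d : ℤ) where

  -- The second summand is the conjugate of the first, so the sum is twice a rational part; the
  -- additional power of `z` is then pulled to the front.
  powers-traceˡ : ∀ z w k l →
    _⊕_ d (_⊗_ d (_^'_ d z (k ℕ.+ 1)) (_^'_ d w l)) (_⊗_ d (_^'_ d (conj d z) (k ℕ.+ 1)) (_^'_ d (conj d w) l))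
      ≡ (+ 2 * proj₁ (_⊗_ d z (_⊗_ d (_^'_ d z k) (_^'_ d w l))) , 0ℤ)
  powers-traceˡ z w k l rewrite ℕₚ.+-comm k 1 = begin
    _⊕_ d W (_⊗_ d (_^'_ d (conj d z) (ℕ.suc k)) (_^'_ d (conj d w) l))  ≡⟨ cong (_⊕_ d W) (conj-^⊗^ d z w (ℕ.suc k) l) ⟩
    _⊕_ d W (conj d W)                                                   ≡⟨ trace d W ⟩
    (+ 2 * proj₁ W , 0ℤ)                                                 ≡⟨ cong (λ t → (+ 2 * proj₁ t , 0ℤ)) (⊗-assoc d z (_^'_ d z k) (_^'_ d w l)) ⟩
    (+ 2 * proj₁ (_⊗_ d z (_⊗_ d (_^'_ d z k) (_^'_ d w l))) , 0ℤ)       ∎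
    where
    open ≡-Reasoning
    W = _⊗_ d (_^'_ d z (ℕ.suc k)) (_^'_ d w l)

  powers-traceʳ : ∀ z w k l →
    _⊕_ d (_⊗_ d (_^'_ d z k) (_^'_ d w (l ℕ.+ 1))) (_⊗_ d (_^'_ d (conj d z) k) (_^'_ d (conj d w) (l ℕ.+ 1)))
      ≡ (+ 2 * proj₁ (_⊗_ d w (_⊗_ d (_^'_ d z k) (_^'_ d w l))) , 0ℤ)
  powers-traceʳ z w k l = begin
    _⊕_ d (_⊗_ d (_^'_ d z k) (_^'_ d w (l ℕ.+ 1))) (_⊗_ d (_^'_ d (conj d z) k) (_^'_ d (conj d w) (l ℕ.+ 1)))
      ≡⟨ cong₂ (_⊕_ d) (⊗-comm d (_^'_ d z k) _) (⊗-comm d (_^'_ d (conj d z) k) _) ⟩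
    _⊕_ d (_⊗_ d (_^'_ d w (l ℕ.+ 1)) (_^'_ d z k)) (_⊗_ d (_^'_ d (conj d w) (l ℕ.+ 1)) (_^'_ d (conj d z) k))
      ≡⟨ powers-traceˡ w z l k ⟩
    (+ 2 * proj₁ (_⊗_ d w (_⊗_ d (_^'_ d w l) (_^'_ d z k))) , 0ℤ)
      ≡⟨ cong (λ t → (+ 2 * proj₁ (_⊗_ d w t) , 0ℤ)) (⊗-comm d (_^'_ d w l) (_^'_ d z k)) ⟩
    (+ 2 * proj₁ (_⊗_ d w (_⊗_ d (_^'_ d z k) (_^'_ d w l))) , 0ℤ) ∎
    where open ≡-Reasoning

  scaled-equation : ∀ q n N X {W} → q ≥ 1 → W ≡ (+ 2 * X , 0ℤ) →
    + q * + N ≡ (+ q - 1ℤ) ℤ.^ n + -1ℤ ℤ.^ n * - X →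
    ι d (+ (2 ℕ.* q ℕ.* N)) ≡ _⊖_ d (ι d (+ (2 ℕ.* ((q ∸ 1) ^ n)))) (_⊗_ d (ι d (-[1+ 0 ] ℤ.^ n)) W)
  scaled-equation q n N X q≥1 refl qN = cong₂ _,_ re (im (-1ℤ ℤ.^ n) X)
    where
    open ≡-Reasoning
    im : ∀ S X → 0ℤ ≡ 0ℤ - (S * 0ℤ + 0ℤ * (+ 2 * X))
    im = solve-∀
    alg : ∀ P S X d → + 2 * (P + S * - X) ≡ + 2 * P - (S * (+ 2 * X) + d * (0ℤ * 0ℤ))
    alg = solve-∀
    re : + (2 ℕ.* q ℕ.* N) ≡ + (2 ℕ.* ((q ∸ 1) ^ n)) - (-1ℤ ℤ.^ n * (+ 2 * X) + d * (0ℤ * 0ℤ))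
    re = begin
      + (2 ℕ.* q ℕ.* N)                                                            ≡⟨ cong +_ (ℕₚ.*-assoc 2 q N) ⟩
      + (2 ℕ.* (q ℕ.* N))                                                          ≡⟨ ℤₚ.pos-* 2 (q ℕ.* N) ⟩
      + 2 * + (q ℕ.* N)                                                            ≡⟨ cong (+ 2 *_) (trans (ℤₚ.pos-* q N) qN) ⟩
      + 2 * ((+ q - 1ℤ) ℤ.^ n + -1ℤ ℤ.^ n * - X)                                   ≡⟨ alg ((+ q - 1ℤ) ℤ.^ n) (-1ℤ ℤ.^ n) X d ⟩
      + 2 * (+ q - 1ℤ) ℤ.^ n - (-1ℤ ℤ.^ n * (+ 2 * X) + d * (0ℤ * 0ℤ))             ≡⟨ cong (_- (-1ℤ ℤ.^ n * (+ 2 * X) + d * (0ℤ * 0ℤ))) main ⟨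
      + (2 ℕ.* ((q ∸ 1) ^ n)) - (-1ℤ ℤ.^ n * (+ 2 * X) + d * (0ℤ * 0ℤ))            ∎
      where
      -- By `q ≥ 1` the truncated `q ∸ 1` is the integer `q - 1`.
      main : + (2 ℕ.* ((q ∸ 1) ^ n)) ≡ + 2 * (+ q - 1ℤ) ℤ.^ n
      main = trans (ℤₚ.pos-* 2 ((q ∸ 1) ^ n)) (cong (+ 2 *_) (trans (pos-^ (q ∸ 1) n)
        (cong (ℤ._^ n) (sym (trans (ℤₚ.m-n≡m⊖n q 1) (ℤₚ.⊖-≥ q≥1))))))

module Evaluation {c ℓ : Level} {q : ℕ} (F : FiniteField c ℓ q) (q-odd : q % 2 ≡ 1)
  (n : ℕ) (a : Fin n → FiniteField.Carrier F) (a≉0 : ∀ i → ¬ FiniteField._≈_ F (a i) (FiniteField.0# F))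
  (b : FiniteField.Carrier F) (b≉0 : ¬ FiniteField._≈_ F b (FiniteField.0# F)) where

  open FieldSums F
  open QuadraticCharacter F q-odd
  open Counting F q-odd
  open FiniteField F using (_≟_; 0#)

  m N : ℕ
  m = mCount F n a b
  N = Nstar F n a b

  q≥1 : q ≥ 1
  q≥1 = ℕₚ.n≢0⇒n>0 λ { refl → contradiction q-odd λ () }

  powers : ∀ D → ℤ → ℤ[√ D ]
  powers D e = _⊗_ D (_^'_ D (1ℤ , - e) m) (_^'_ D (1ℤ , e) (n ∸ m))

  -- `D` and `e` are variables so that the literal values of `d` and `χ(b)` can be inserted, and
  -- with them the ring of the statement.
  qN : ∀ {D e} → d ≡ D → χ F b ≡ e →
    + q * + N ≡ (+ q - 1ℤ) ℤ.^ n + -1ℤ ℤ.^ n * - (proj₁ (powers D e) - + q * (e * proj₂ (powers D e)))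
  qN refl refl = trans (q*Nstar n a a≉0 b) (cong (λ t → (+ q - 1ℤ) ℤ.^ n + -1ℤ ℤ.^ n * t) (begin
    proj₁ z * (+ q * δ b 0# - 1ℤ) + + q * (proj₂ z * χ F b)
      ≡⟨ cong₂ (λ z i → proj₁ z * (+ q * i - 1ℤ) + + q * (proj₂ z * χ F b)) (charProduct-powers n a a≉0 b b≉0) (𝟙-no (b ≟ 0#) b≉0) ⟩
    proj₁ z′ * (+ q * 0ℤ - 1ℤ) + + q * (proj₂ z′ * χ F b)
      ≡⟨ alg (proj₁ z′) (proj₂ z′) (+ q) (χ F b) ⟩
    - (proj₁ z′ - + q * (χ F b * proj₂ z′)) ∎))
    where
    open ≡-Reasoning
    z = charProduct n a
    z′ = powers d (χ F b)
    alg : ∀ u v k e → u * (k * 0ℤ - 1ℤ) + k * (v * e) ≡ - (u - k * (e * v))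
    alg = solve-∀

  Equation : (D : ℤ) → ℤ[√ D ] → Set
  Equation D W = ι D (+ (2 ℕ.* q ℕ.* N)) ≡ _⊖_ D (ι D (+ (2 ℕ.* ((q ∸ 1) ^ n)))) (_⊗_ D (ι D (-[1+ 0 ] ℤ.^ n)) W)

  -- With `d = q`, the number `u - q χ(b) v` is the rational part of `(1 - χ(b)√d)(u + v√d)`, so the
  -- new factor is of the kind counted by `m`.
  formula⁺ : ε ≡ 1ℤ → Equation (+ q) (_⊕_ (+ q)
    (_⊗_ (+ q) (_^'_ (+ q) (1-√ (+ q)) (m ℕ.+ 1)) (_^'_ (+ q) (1+√ (+ q)) (n ∸ m)))
    (_⊗_ (+ q) (_^'_ (+ q) (1+√ (+ q)) (m ℕ.+ 1)) (_^'_ (+ q) (1-√ (+ q)) (n ∸ m))))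
  formula⁺ ε≡1 = [ (λ e → scaled-equation D q n N _ q≥1 (trans (powers-traceˡ D (1-√ D) (1+√ D) m (n ∸ m)) (re 1ℤ)) (qN d≡q e))
                 -- For `χ(b) = -1` the elements `1 - √d` and `1 + √d` trade roles, which only swaps
                 -- the two conjugate summands.
                 , (λ e → scaled-equation D q n N _ q≥1 (trans (⊕-comm D (_⊗_ D (_^'_ D (1-√ D) (m ℕ.+ 1)) (_^'_ D (1+√ D) (n ∸ m))) _)
                            (trans (powers-traceˡ D (1+√ D) (1-√ D) m (n ∸ m)) (re -1ℤ))) (qN d≡q e))
                 ]′ (χ-± b≉0)
    where
    D = + q
    d≡q : d ≡ D
    d≡q = trans (cong (_* + q) ε≡1) (ℤₚ.*-identityˡ (+ q))
    alg : ∀ u v k e → + 2 * (1ℤ * u + k * (- e * v)) ≡ + 2 * (u - k * (e * v))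
    alg = solve-∀
    re : ∀ e → (+ 2 * proj₁ (_⊗_ D (1ℤ , - e) (powers D e)) , 0ℤ) ≡ (+ 2 * (proj₁ (powers D e) - + q * (e * proj₂ (powers D e))) , 0ℤ)
    re e = cong (_, 0ℤ) (alg (proj₁ (powers D e)) (proj₂ (powers D e)) (+ q) e)

  -- With `d = -q`, the same number is the rational part of `(1 + χ(b)√d)(u + v√d)`, so the new
  -- factor joins the other power.
  formula⁻ : ε ≡ -1ℤ → Equation (- + q) (_⊕_ (- + q)
    (_⊗_ (- + q) (_^'_ (- + q) (1-√ (- + q)) m) (_^'_ (- + q) (1+√ (- + q)) (n ∸ m ℕ.+ 1)))
    (_⊗_ (- + q) (_^'_ (- + q) (1+√ (- + q)) m) (_^'_ (- + q) (1-√ (- + q)) (n ∸ m ℕ.+ 1))))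
  formula⁻ ε≡-1 = [ (λ e → scaled-equation D q n N _ q≥1 (trans (powers-traceʳ D (1-√ D) (1+√ D) m (n ∸ m)) (re 1ℤ)) (qN d≡-q e))
                  , (λ e → scaled-equation D q n N _ q≥1 (trans (⊕-comm D (_⊗_ D (_^'_ D (1-√ D) m) (_^'_ D (1+√ D) (n ∸ m ℕ.+ 1))) _)
                             (trans (powers-traceʳ D (1+√ D) (1-√ D) m (n ∸ m)) (re -1ℤ))) (qN d≡-q e))
                  ]′ (χ-± b≉0)
    where
    D = - + q
    d≡-q : d ≡ D
    d≡-q = trans (cong (_* + q) ε≡-1) (ℤₚ.-1*i≡-i (+ q))
    alg : ∀ u v k e → + 2 * (1ℤ * u + - k * (e * v)) ≡ + 2 * (u - k * (e * v))
    alg = solve-∀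
    re : ∀ e → (+ 2 * proj₁ (_⊗_ D (1ℤ , e) (powers D e)) , 0ℤ) ≡ (+ 2 * (proj₁ (powers D e) - + q * (e * proj₂ (powers D e))) , 0ℤ)
    re e = cong (_, 0ℤ) (alg (proj₁ (powers D e)) (proj₂ (powers D e)) (+ q) e)

-- The value of `χ(-1)`, and powers of `p` modulo 4.

module _ {c ℓ : Level} {q : ℕ} (F : FiniteField c ℓ q) (q-odd : q % 2 ≡ 1) where

  open QuadraticCharacter F q-odd

  private
    -- The natural number `k` represents `-e` modulo 4 (1 for `e = -1`, 3 for `e = 1`), so that
    -- `4 ∣ q - ε` becomes a statement on remainders that refutes the wrong sign.
    4∣q+ : ∀ {e} k → ε ≡ e → + 4 ∣ + k + e → (q % 4 ℕ.+ k % 4) % 4 ≡ 0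
    4∣q+ {e} k refl 4∣k+e = trans (sym (%-distribˡ-+ q k 4)) (n∣m⇒m%n≡0 (q ℕ.+ k) 4
      (∣⇒∣ᵤ (subst (+ 4 ∣_) (alg (+ q) e (+ k)) (∣m∣n⇒∣m+n 4∣q-ε 4∣k+e))))
      where
      alg : ∀ q e k → q - e + (k + e) ≡ q + k
      alg = solve-∀

  ε≡1 : q % 4 ≡ 1 → ε ≡ 1ℤ
  ε≡1 q%4≡1 = [ (λ e → e) , (λ e → contradiction (trans (cong (λ r → (r ℕ.+ 1) % 4) (sym q%4≡1)) (4∣q+ 1 e (divides 0ℤ refl))) λ ()) ]′ (χ-± -1≉0)

  ε≡-1 : q % 4 ≡ 3 → ε ≡ -1ℤ
  ε≡-1 q%4≡3 = [ (λ e → contradiction (trans (cong (λ r → (r ℕ.+ 3) % 4) (sym q%4≡3)) (4∣q+ 3 e (divides 1ℤ refl))) λ ()) , (λ e → e) ]′ (χ-± -1≉0)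

^-%≡1 : ∀ p s k .{{_ : ℕ.NonZero k}} → 1 % k ≡ 1 → p % k ≡ 1 → p ^ s % k ≡ 1
^-%≡1 p ℕ.zero    k 1%k p%k = 1%k
^-%≡1 p (ℕ.suc s) k 1%k p%k = trans (%-distribˡ-* p (p ^ s) k) (trans (cong₂ (λ x y → (x ℕ.* y) % k) p%k (^-%≡1 p s k 1%k p%k)) 1%k)

module _ {p} (p%4≡3 : p % 4 ≡ 3) where

  private
    step : ∀ s {r} → p ^ s % 4 ≡ r → p ^ ℕ.suc s % 4 ≡ (3 ℕ.* r) % 4
    step s e = trans (%-distribˡ-* p (p ^ s) 4) (cong₂ (λ x y → (x ℕ.* y) % 4) p%4≡3 e)

  ^-even-%4 : ∀ s → s % 2 ≡ 0 → p ^ s % 4 ≡ 1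
  ^-even-%4 0                 _ = refl
  ^-even-%4 (ℕ.suc (ℕ.suc s)) e = step (ℕ.suc s) (step s (^-even-%4 s e))

  ^-odd-%4 : ∀ s → s % 2 ≡ 1 → p ^ s % 4 ≡ 3
  ^-odd-%4 1                 _ = step 0 refl
  ^-odd-%4 (ℕ.suc (ℕ.suc s)) e = step (ℕ.suc s) (step s (^-odd-%4 s e))

theorem3p3 : ∀ {c ℓ : Level} (p s : ℕ) → Prime p → p % 2 ≡ 1 → s ≥ 1 →
  (F : FiniteField c ℓ (p ^ s)) →
  (n : ℕ) → n ≥ 1 →
  (a : Fin n → FiniteField.Carrier F) → (∀ i → ¬ FiniteField._≈_ F (a i) (FiniteField.0# F)) →
  (b : FiniteField.Carrier F) → ¬ FiniteField._≈_ F b (FiniteField.0# F) →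
  let q = p ^ s
      N = Nstar F n a b
      m = mCount F n a b
      sgn = (ℤ.-[1+ 0 ]) ℤ.^ n
      lhs = ℤ.+ (2 Data.Nat.* q Data.Nat.* N)
      main = ℤ.+ (2 Data.Nat.* ((q ∸ 1) ^ n))
  in ((p % 4 ≡ 1 ⊎ (p % 4 ≡ 3 × s % 2 ≡ 0)) →
        ι (+ q) lhs ≡
          _⊖_ (+ q) (ι (+ q) main)
            (_⊗_ (+ q) (ι (+ q) sgn)
              (_⊕_ (+ q)
                (_⊗_ (+ q) (_^'_ (+ q) (1-√ (+ q)) (m Data.Nat.+ 1)) (_^'_ (+ q) (1+√ (+ q)) (n ∸ m)))
                (_⊗_ (+ q) (_^'_ (+ q) (1+√ (+ q)) (m Data.Nat.+ 1)) (_^'_ (+ q) (1-√ (+ q)) (n ∸ m))))))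
   × ((p % 4 ≡ 3 × s % 2 ≡ 1) →
        ι (- + q) lhs ≡
          _⊖_ (- + q) (ι (- + q) main)
            (_⊗_ (- + q) (ι (- + q) sgn)
              (_⊕_ (- + q)
                (_⊗_ (- + q) (_^'_ (- + q) (1-√ (- + q)) m) (_^'_ (- + q) (1+√ (- + q)) (n ∸ m Data.Nat.+ 1)))
                (_⊗_ (- + q) (_^'_ (- + q) (1+√ (- + q)) m) (_^'_ (- + q) (1-√ (- + q)) (n ∸ m Data.Nat.+ 1))))))
theorem3p3 p s _ p-odd _ F n _ a a≉0 b b≉0 =
    (λ cond → formula⁺ (ε≡1 F q-odd ([ ^-%≡1 p s 4 refl , (λ (p%4≡3 , even) → ^-even-%4 p%4≡3 s even) ]′ cond)))
  , (λ (p%4≡3 , odd) → formula⁻ (ε≡-1 F q-odd (^-odd-%4 p%4≡3 s odd)))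
  where
  q-odd : p ^ s % 2 ≡ 1
  q-odd = ^-%≡1 p s 2 refl p-odd
  open Evaluation F q-odd n a a≉0 b b≉0
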